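{- Suppose that every finite simple graph $G$ satisfies $S_k(G) \leq B_k(G)$ for all $1 \leq k \leq n(G)$. Then every quiver $G$ satisfies $S_k(G) \leq B_k(G)$ for all $1 \leq k \leq n(G)$.
   Context: A quiver $G$ is a finite undirected graph with $n=n(G)\ge 1$ vertices in which loops (possibly several at the same vertex) and multiple edges between distinct vertices are allowed. $m=m(G)$ is the total number of edges, where every loop and every edge of a multiple connection is counted. A finite simple graph is a quiver with no loops and no multiple connections. The Kirchhoff matrix $K$ of $G$ is the symmetric $n\times n$ matrix with $K_{ij}=-(\text{number of edges between } i \text{ and } j)$ for $i\neq j$, and $K_{ii}=$ the degree of vertex $i$, i.e. the number of edges attached to $i$, counted with multiplicity, where each loop at $i$ counts as $1$. Its eigenvalues are $\lambda_1\ge\lambda_2\ge\dots\ge\lambda_n$, and $S_k(G)=\sum_{j=1}^k\lambda_j$. The redundancy $r=r(G)$ is the minimal number of edges whose removal leaves no multiple connections between distinct vertices; equivalently $r=\sum_{i<j}(\mathrm{sign}(K_{ij})-K_{ij})$ (multiple loops at a vertex do not count as redundant). Set $B_k(G)=m+r+k(k+1)/2$. For a finite simple graph $r=0$, so $B_k(G)=m+k(k+1)/2$. -}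

module Defs where

open import Algebra.Bundles using (CommutativeRing)
open import Data.Fin using (Fin; inject≤; _≟_) renaming (_≤_ to _≤ᶠ_)
open import Data.Fin.Properties using (all?)
open import Data.Integer using (ℤ; +_; -[1+_]) renaming (-_ to -ᶻ_)
open import Data.List using (List; []; _∷_; _++_; map; filter; length)
open import Data.List.Extrema.Nat using (min)
open import Data.List.Relation.Unary.All using (All)
open import Data.Nat using (ℕ; suc; NonZero; _∸_; _/_)
  renaming (_+_ to _+ᴺ_; _*_ to _*ᴺ_; _≤_ to _≤ᴺ_; _≤?_ to _≤?ᴺ_)
open import Data.Product using (Σ-syntax; ∃; _×_; _,_; proj₁; proj₂)
open import Data.Product.Properties using (≡-dec)
open import Data.Sum using (_⊎_)
open import Data.Vec.Functional using (Vector)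
open import Level using (0ℓ)
open import Relation.Binary using (Rel; IsDecTotalOrder)
open import Relation.Binary.PropositionalEquality using (_≡_; _≢_)
open import Relation.Nullary using (¬_; Dec; yes; no; ¬?; _⊎-dec_; _→-dec_)
import Algebra.Definitions.RawMonoid as RawMonoidOps

-- The real numbers, characterised (classically, up to unique isomorphism) as a
-- complete ordered field.  The decidable total order together with suprema of
-- arbitrary bounded inhabited predicates makes this the classical notion.
record CompleteOrderedField : Set₁ where
  infix 4 _≤_
  field
    commutativeRing : CommutativeRing 0ℓ 0ℓ
  open CommutativeRing commutativeRing public
  field
    _≤_             : Rel Carrier 0ℓ
    isDecTotalOrder : IsDecTotalOrder _≈_ _≤_
    0≉1             : ¬ (0# ≈ 1#)
    inverse         : ∀ x → ¬ (x ≈ 0#) → ∃ λ y → x * y ≈ 1#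
    +-monoʳ-≤       : ∀ x {y z} → y ≤ z → x + y ≤ x + z
    *-nonNegative   : ∀ {x y} → 0# ≤ x → 0# ≤ y → 0# ≤ x * y

  IsUpperBound : (Carrier → Set) → Carrier → Set
  IsUpperBound P b = ∀ x → P x → x ≤ b

  field
    supremum : (P : Carrier → Set) → ∃ P → ∃ (IsUpperBound P) →
               ∃ λ s → IsUpperBound P s × (∀ b → IsUpperBound P b → s ≤ b)

-- An edge is stored as a pair of endpoints, but every notion below is
-- invariant under swapping the two components; a loop at i is (i , i).
Edge : ℕ → Set
Edge n = Fin n × Fin n

record Quiver : Set where
  field
    n             : ℕ
    .{{n-nonZero}} : NonZero n
    edges         : List (Edge n)

  m : ℕ
  m = length edges

module _ {n : ℕ} where

  Joins : Fin n → Fin n → Edge n → Set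
  Joins i j e = (e ≡ (i , j)) ⊎ (e ≡ (j , i))

  joins? : ∀ i j e → Dec (Joins i j e)
  joins? i j e = ≡-dec _≟_ _≟_ e (i , j) ⊎-dec ≡-dec _≟_ _≟_ e (j , i)

  Incident : Fin n → Edge n → Set
  Incident i e = (proj₁ e ≡ i) ⊎ (proj₂ e ≡ i)

  incident? : ∀ i e → Dec (Incident i e)
  incident? i e = (proj₁ e ≟ i) ⊎-dec (proj₂ e ≟ i)

  multiplicity : List (Edge n) → Fin n → Fin n → ℕ
  multiplicity es i j = length (filter (joins? i j) es)

  -- A loop at i is a single list entry, hence contributes 1.
  degree : List (Edge n) → Fin n → ℕ
  degree es i = length (filter (incident? i) es)

  NoLoops : List (Edge n) → Set
  NoLoops = All λ e → proj₁ e ≢ proj₂ e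

  NoMultipleConnections : List (Edge n) → Set
  NoMultipleConnections es = ∀ i j → i ≢ j → multiplicity es i j ≤ᴺ 1

  noMultipleConnections? : ∀ es → Dec (NoMultipleConnections es)
  noMultipleConnections? es =
    all? λ i → all? λ j → ¬? (i ≟ j) →-dec (multiplicity es i j ≤?ᴺ 1)

IsSimple : Quiver → Set
IsSimple G = NoLoops edges × NoMultipleConnections edges
  where open Quiver G

sublists : ∀ {A : Set} → List A → List (List A)
sublists []       = [] ∷ []
sublists (x ∷ xs) = map (x ∷_) (sublists xs) ++ sublists xs

-- The lists `kept` are what remains after removing edges; the first argument
-- m of `min` corresponds to removing every edge, so it does not affect the
-- minimum.
redundancy : Quiver → ℕ
redundancy G = min m (map (λ kept → m ∸ length kept)
                          (filter noMultipleConnections? (sublists edges)))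
  where open Quiver G

kirchhoff : (G : Quiver) → Fin (Quiver.n G) → Fin (Quiver.n G) → ℤ
kirchhoff G i j with i ≟ j
... | yes _ = + degree (Quiver.edges G) i
... | no  _ = -ᶻ (+ multiplicity (Quiver.edges G) i j)

B : Quiver → ℕ → ℕ
B G k = Quiver.m G +ᴺ redundancy G +ᴺ (k *ᴺ (k +ᴺ 1)) / 2

module Spectral (ℝ : CompleteOrderedField) where
  open CompleteOrderedField ℝ
  open RawMonoidOps +-rawMonoid public using (sum) renaming (_×_ to _·ᴺ_)

  fromℕ : ℕ → Carrier
  fromℕ a = a ·ᴺ 1#

  fromℤ : ℤ → Carrier
  fromℤ (+ a)    = fromℕ a
  fromℤ -[1+ a ] = - fromℕ (suc a)

  Matrix : ℕ → Set
  Matrix n = Fin n → Fin n → Carrier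

  LinearlyIndependent : ∀ {n p} → Vector (Vector Carrier n) p → Set
  LinearlyIndependent {n} {p} v =
    ∀ (c : Vector Carrier p) →
    (∀ (a : Fin n) → sum (λ i → c i * v i a) ≈ 0#) → ∀ i → c i ≈ 0#

  IsEigenvector : ∀ {n} → Matrix n → Carrier → Vector Carrier n → Set
  IsEigenvector M μ v =
    ¬ (∀ a → v a ≈ 0#) × (∀ a → sum (λ b → M a b * v b) ≈ μ * v a)

  -- λs lists the eigenvalues of M in non-increasing order, each repeated
  -- according to its multiplicity (the dimension of its eigenspace): there
  -- are n linearly independent eigenvectors, the i-th one for λs i.  For
  -- symmetric M such a list exists and is unique up to _≈_.
  IsSpectrum : ∀ {n} → Matrix n → Vector Carrier n → Set
  IsSpectrum {n} M λs =
    (∀ i j → i ≤ᶠ j → λs j ≤ λs i) ×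
    (Σ[ v ∈ Vector (Vector Carrier n) n ]
      LinearlyIndependent v × (∀ i → IsEigenvector M (λs i) (v i)))

  kirchhoffℝ : (G : Quiver) → Matrix (Quiver.n G)
  kirchhoffℝ G i j = fromℤ (kirchhoff G i j)

  partialSum : ∀ {n} → Vector Carrier n → (k : ℕ) → k ≤ᴺ n → Carrier
  partialSum λs k k≤n = sum {k} λ j → λs (inject≤ j k≤n)

  -- S_k(G) ≤ B_k(G), for S_k(G) the sum of the k largest eigenvalues of the
  -- Kirchhoff matrix.
  S≤B : (G : Quiver) (k : ℕ) → k ≤ᴺ Quiver.n G → Set
  S≤B G k k≤n = ∀ λs → IsSpectrum (kirchhoffℝ G) λs →
                partialSum λs k k≤n ≤ fromℕ (B G k)

{-# OPTIONS --safe #-}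

-- Write K(G) = Σₑ xₑ xₑᵀ over the edges e of G, where xₑ = δₐ for a loop at a
-- and xₑ = δₐ - δ_b for an edge from a to b, so that |xₑ|² is 1 for a loop and 2
-- otherwise.  Take orthogonal eigenvectors u₁, …, u_k of K(G) for the k largest
-- eigenvalues: S_k(G) is the trace of the compression of K(G) to their span, to
-- which each edge contributes at most |xₑ|² by Bessel's inequality.  Deleting
-- redundant edges and loops leaves a simple graph H, so
-- S_k(G) ≤ tr(compression of K(H)) + 2 r + #loops, and the trace is at most
-- S_k(H) by Ky Fan's principle, which is bounded by hypothesis.
-- Both steps need orthogonal eigenbases.  A symmetric matrix M has a bottom
-- eigenvector because s = sup {t | t |v|² ≤ v · M v for all v} makes M - s
-- singular; deflation yields the others.

module Submission where

open import Defs
open import Algebra.Solver.Ring.AlmostCommutativeRing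
  using (AlmostCommutativeRing; fromCommutativeRing; _-Raw-AlmostCommutative⟶_)
open import Data.Fin as Fin using (Fin; zero; suc; inject≤; punchIn; punchOut)
import Data.Fin.Properties as Finₚ
open import Data.Integer as ℤ using (ℤ; +_; -[1+_])
import Data.Integer.Properties as ℤₚ
open import Data.List using (List; []; _∷_; map; filter; length; foldr)
import Data.List.Extrema.Nat as Extrema
open import Data.List.Membership.Propositional using (_∈_)
open import Data.List.Membership.Propositional.Properties
  using (∈-map⁺; ∈-map⁻; ∈-filter⁺; ∈-filter⁻; ∈-++⁺ˡ; ∈-++⁺ʳ; ∈-++⁻)
open import Data.List.Properties using (filter-accept; filter-reject)
open import Data.List.Relation.Binary.Sublist.Propositional using (_⊆_; []; _∷_; _∷ʳ_)
open import Data.List.Relation.Binary.Sublist.Propositional.Properties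
  using (filter⁺; filter-⊆; length-mono-≤)
import Data.List.Relation.Unary.All as All
open import Data.List.Relation.Unary.All.Properties using (all-filter)
open import Data.List.Relation.Unary.Any using (here)
open import Data.Maybe using (Maybe; just; nothing)
open import Data.Nat as ℕ using (ℕ; zero; suc; _∸_)
import Data.Nat.Properties as ℕₚ
open import Data.Product using (_,_; proj₁; proj₂; _×_; ∃; ∃₂)
open import Data.Sum using (_⊎_; inj₁; inj₂)
import Data.Sum.Effectful.Left as Sumₗ
open import Data.Vec.Functional as Vec using (Vector)
open import Function using (_∘_; id)
open import Level using (0ℓ)
open import Relation.Binary using (IsDecTotalOrder; Poset)
open import Relation.Binary.PropositionalEquality as ≡ using (_≡_; _≢_)
open import Relation.Nullary using (¬_; Dec; yes; no; contradiction; ¬?)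
open import Relation.Nullary.Decidable using (decidable-stable)
import Algebra.Properties.Ring as RingProperties
import Algebra.Properties.Semiring.Mult as SemiringMult
import Algebra.Properties.Semiring.Mult.TCOptimised as Multiples
import Algebra.Properties.Semiring.Sum as SemiringSum
import Algebra.Solver.Ring as RingSolver
import Relation.Binary.Reasoning.PartialOrder as PosetReasoning
import Relation.Binary.Reasoning.Setoid as SetoidReasoning

-- The bookkeeping leaves no slack. A deleted redundant edge costs 2: one unit is its share of `m`,
-- the other its share of `r`. A deleted loop costs exactly its share of `m`, since multiple loops
-- do not enter `r`; this is why loops need the sharper constant 1. Two features of `IsSpectrum`
-- shape the proof. It asks for linearly independent eigenvectors only, so an arbitrary spectrum of
-- K(G) must be compared entry by entry with the eigenvalues of an orthogonal basis. And the
-- hypothesis on simple graphs says something about K(H) only once a spectrum of K(H) has been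
-- exhibited, so the spectral theorem is needed for existence as well. To avoid square roots,
-- eigenvectors v stay unnormalised and carry the weight 1/|v|². Singularity of M - s is obtained
-- without compactness or determinants: if every unit vector had a preimage under M - s, linear
-- algebra would give an explicit ε > 0 with ε |v|² below the form of M - s, and s + ε would
-- contradict the choice of s.

-- Arithmetic of an ordered field, with a ring solver.

module OrderedField (ℝ : CompleteOrderedField) where
  open CompleteOrderedField ℝ hiding (zero)
  open IsDecTotalOrder isDecTotalOrder public
    using (total; antisym; _≟_; _≤?_; isPartialOrder)
    renaming (refl to ≤-refl; trans to ≤-trans; reflexive to ≤-reflexive)
  open RingProperties ring using (-0#≈0#; -‿+-comm; -‿distribˡ-*; -‿distribʳ-*; -‿involutive)

  poset : Poset _ _ _
  poset = record { isPartialOrder = isPartialOrder }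

  module ≈-Reasoning = SetoidReasoning setoid
  module ≤-Reasoning = PosetReasoning poset

  -- The ring solver recognises cancellations only if equality of its
  -- coefficients is decided by computation, hence integers rather than Carrier.
  module IntegerCoefficients where
    open Multiples semiring using (×1-homo-*; 1+×; ×-homo-+) renaming (_×_ to _×′_)

    -- With the optimised multiples `⟦ + 1 ⟧` reduces to `1#` itself, so that `con (+ 1)` in solver
    -- equations matches `1#` in the goals.
    ⟦_⟧ : ℤ → Carrier
    ⟦ + a ⟧      = a ×′ 1#
    ⟦ -[1+ a ] ⟧ = - (suc a ×′ 1#)

    ⟦⟧-neg : ∀ i → ⟦ ℤ.- i ⟧ ≈ - ⟦ i ⟧
    ⟦⟧-neg (+ zero)     = sym -0#≈0#
    ⟦⟧-neg (+ suc a)    = refl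
    ⟦⟧-neg (-[1+ a ])   = sym (-‿involutive _)

    ⟦⟧-⊖ : ∀ a b → ⟦ a ℤ.⊖ b ⟧ ≈ a ×′ 1# - b ×′ 1#
    ⟦⟧-⊖ a zero = begin
      ⟦ a ℤ.⊖ 0 ⟧      ≡⟨ ≡.cong ⟦_⟧ (ℤₚ.⊖-≥ {a} {0} ℕ.z≤n) ⟩
      a ×′ 1#          ≈⟨ +-identityʳ _ ⟨
      a ×′ 1# + 0#     ≈⟨ +-congˡ -0#≈0# ⟨
      a ×′ 1# - 0#     ∎
      where open ≈-Reasoning
    ⟦⟧-⊖ zero (suc b) = sym (+-identityˡ _)
    ⟦⟧-⊖ (suc a) (suc b) = begin
      ⟦ suc a ℤ.⊖ suc b ⟧                       ≡⟨ ≡.cong ⟦_⟧ (ℤₚ.[1+m]⊖[1+n]≡m⊖n a b) ⟩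
      ⟦ a ℤ.⊖ b ⟧                               ≈⟨ ⟦⟧-⊖ a b ⟩
      a ×′ 1# - b ×′ 1#                         ≈⟨ +-congʳ (+-identityˡ _) ⟨
      (0# + a ×′ 1#) - b ×′ 1#                  ≈⟨ +-congʳ (+-congʳ (-‿inverseʳ 1#)) ⟨
      ((1# - 1#) + a ×′ 1#) - b ×′ 1#           ≈⟨ +-congʳ (+-assoc _ _ _) ⟩
      (1# + (- 1# + a ×′ 1#)) - b ×′ 1#         ≈⟨ +-congʳ (+-congˡ (+-comm _ _)) ⟩
      (1# + (a ×′ 1# - 1#)) - b ×′ 1#           ≈⟨ +-congʳ (+-assoc _ _ _) ⟨
      ((1# + a ×′ 1#) - 1#) - b ×′ 1#           ≈⟨ +-assoc _ _ _ ⟩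
      (1# + a ×′ 1#) + (- 1# - b ×′ 1#)         ≈⟨ +-congˡ (-‿+-comm _ _) ⟩
      (1# + a ×′ 1#) - (1# + b ×′ 1#)           ≈⟨ +-cong (1+× a 1#) (-‿cong (1+× b 1#)) ⟨
      suc a ×′ 1# - suc b ×′ 1#                 ∎
      where open ≈-Reasoning

    ⟦⟧-+ : ∀ i j → ⟦ i ℤ.+ j ⟧ ≈ ⟦ i ⟧ + ⟦ j ⟧
    ⟦⟧-+ (+ a)    (+ b)    = ×-homo-+ 1# a b
    ⟦⟧-+ (+ a)    -[1+ b ] = ⟦⟧-⊖ a (suc b)
    ⟦⟧-+ -[1+ a ] (+ b)    = trans (⟦⟧-⊖ b (suc a)) (+-comm _ _)
    ⟦⟧-+ -[1+ a ] -[1+ b ] = begin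
      - (suc (suc (a ℕ.+ b)) ×′ 1#)          ≡⟨ ≡.cong (λ n → - (suc n ×′ 1#)) (≡.sym (ℕₚ.+-suc a b)) ⟩
      - ((suc a ℕ.+ suc b) ×′ 1#)            ≈⟨ -‿cong (×-homo-+ 1# (suc a) (suc b)) ⟩
      - (suc a ×′ 1# + suc b ×′ 1#)          ≈⟨ -‿+-comm _ _ ⟨
      - (suc a ×′ 1#) - suc b ×′ 1#          ∎
      where open ≈-Reasoning

    ⟦⟧-*⁺ : ∀ a j → ⟦ (+ a) ℤ.* j ⟧ ≈ (a ×′ 1#) * ⟦ j ⟧
    ⟦⟧-*⁺ a (+ b) = begin
      ⟦ (+ a) ℤ.* (+ b) ⟧     ≡⟨ ≡.cong ⟦_⟧ (≡.sym (ℤₚ.pos-* a b)) ⟩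
      (a ℕ.* b) ×′ 1#         ≈⟨ ×1-homo-* a b ⟩
      (a ×′ 1#) * (b ×′ 1#)   ∎
      where open ≈-Reasoning
    ⟦⟧-*⁺ a -[1+ b ] = begin
      ⟦ (+ a) ℤ.* (ℤ.- (+ suc b)) ⟧    ≡⟨ ≡.cong ⟦_⟧ (ℤₚ.neg-distribʳ-* (+ a) (+ suc b)) ⟨
      ⟦ ℤ.- ((+ a) ℤ.* (+ suc b)) ⟧    ≈⟨ ⟦⟧-neg ((+ a) ℤ.* (+ suc b)) ⟩
      - ⟦ (+ a) ℤ.* (+ suc b) ⟧        ≈⟨ -‿cong (⟦⟧-*⁺ a (+ suc b)) ⟩
      - ((a ×′ 1#) * (suc b ×′ 1#))    ≈⟨ -‿distribʳ-* _ _ ⟩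
      (a ×′ 1#) * - (suc b ×′ 1#)      ∎
      where open ≈-Reasoning

    ⟦⟧-* : ∀ i j → ⟦ i ℤ.* j ⟧ ≈ ⟦ i ⟧ * ⟦ j ⟧
    ⟦⟧-* (+ a)    j = ⟦⟧-*⁺ a j
    ⟦⟧-* -[1+ a ] j = begin
      ⟦ (ℤ.- (+ suc a)) ℤ.* j ⟧   ≡⟨ ≡.cong ⟦_⟧ (ℤₚ.neg-distribˡ-* (+ suc a) j) ⟨
      ⟦ ℤ.- ((+ suc a) ℤ.* j) ⟧   ≈⟨ ⟦⟧-neg ((+ suc a) ℤ.* j) ⟩
      - ⟦ (+ suc a) ℤ.* j ⟧       ≈⟨ -‿cong (⟦⟧-*⁺ (suc a) j) ⟩
      - ((suc a ×′ 1#) * ⟦ j ⟧)   ≈⟨ -‿distribˡ-* _ _ ⟩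
      - (suc a ×′ 1#) * ⟦ j ⟧     ∎
      where open ≈-Reasoning

    almostCommutativeRing : AlmostCommutativeRing _ _
    almostCommutativeRing = fromCommutativeRing commutativeRing

    morphism : ℤ.+-*-rawRing -Raw-AlmostCommutative⟶ almostCommutativeRing
    morphism = record
      { ⟦_⟧ = ⟦_⟧ ; +-homo = ⟦⟧-+ ; *-homo = ⟦⟧-* ; -‿homo = ⟦⟧-neg ; 0-homo = refl ; 1-homo = refl }

    _coeff≟_ : ∀ i j → Maybe (⟦ i ⟧ ≈ ⟦ j ⟧)
    i coeff≟ j with i ℤ.≟ j
    ... | yes i≡j = just (reflexive (≡.cong ⟦_⟧ i≡j))
    ... | no  _   = nothing

  open RingSolver ℤ.+-*-rawRing IntegerCoefficients.almostCommutativeRing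
    IntegerCoefficients.morphism IntegerCoefficients._coeff≟_ public
    using (solve; _:=_; _:+_; _:*_; _:-_; :-_; con)

  private variable
    x y z w d : Carrier

  ≤⇒0≤- : x ≤ y → 0# ≤ y - x
  ≤⇒0≤- {x} {y} x≤y = begin
    0#        ≈⟨ -‿inverseˡ x ⟨
    - x + x   ≤⟨ +-monoʳ-≤ (- x) x≤y ⟩
    - x + y   ≈⟨ +-comm _ _ ⟩
    y - x     ∎
    where open ≤-Reasoning

  0≤-⇒≤ : 0# ≤ y - x → x ≤ y
  0≤-⇒≤ {y} {x} 0≤y-x = begin
    x            ≈⟨ +-identityʳ x ⟨
    x + 0#       ≤⟨ +-monoʳ-≤ x 0≤y-x ⟩
    x + (y - x)  ≈⟨ solve 2 (λ x y → x :+ (y :- x) := y) refl x y ⟩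
    y            ∎
    where open ≤-Reasoning

  +-mono-≤ : x ≤ y → z ≤ w → x + z ≤ y + w
  +-mono-≤ {x} {y} {z} {w} x≤y z≤w = begin
    x + z  ≤⟨ +-monoʳ-≤ x z≤w ⟩
    x + w  ≈⟨ +-comm _ _ ⟩
    w + x  ≤⟨ +-monoʳ-≤ w x≤y ⟩
    w + y  ≈⟨ +-comm _ _ ⟩
    y + w  ∎
    where open ≤-Reasoning

  +-nonNegative : 0# ≤ x → 0# ≤ y → 0# ≤ x + y
  +-nonNegative 0≤x 0≤y = ≤-trans (≤-reflexive (sym (+-identityˡ 0#))) (+-mono-≤ 0≤x 0≤y)

  neg-nonNegative : x ≤ 0# → 0# ≤ - x
  neg-nonNegative {x} x≤0 = ≤-trans (≤⇒0≤- x≤0) (≤-reflexive (+-identityˡ (- x)))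

  *-monoˡ-≤ : 0# ≤ z → x ≤ y → z * x ≤ z * y
  *-monoˡ-≤ {z} {x} {y} 0≤z x≤y = 0≤-⇒≤ (≤-trans (*-nonNegative 0≤z (≤⇒0≤- x≤y))
    (≤-reflexive (solve 3 (λ x y z → z :* (y :- x) := z :* y :- z :* x) refl x y z)))

  *-monoʳ-≤ : 0# ≤ z → x ≤ y → x * z ≤ y * z
  *-monoʳ-≤ {z} {x} {y} 0≤z x≤y = begin
    x * z  ≈⟨ *-comm x z ⟩
    z * x  ≤⟨ *-monoˡ-≤ 0≤z x≤y ⟩
    z * y  ≈⟨ *-comm z y ⟩
    y * z  ∎
    where open ≤-Reasoning

  square-nonNegative : ∀ x → 0# ≤ x * x
  square-nonNegative x with total 0# x
  ... | inj₁ 0≤x = *-nonNegative 0≤x 0≤x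
  ... | inj₂ x≤0 = ≤-trans (*-nonNegative (neg-nonNegative x≤0) (neg-nonNegative x≤0))
    (≤-reflexive (solve 1 (λ x → (:- x) :* (:- x) := x :* x) refl x))

  0≤1 : 0# ≤ 1#
  0≤1 = ≤-trans (square-nonNegative 1#) (≤-reflexive (*-identityˡ 1#))

  1≰0 : ¬ 1# ≤ 0#
  1≰0 1≤0 = 0≉1 (antisym 0≤1 1≤0)

  -- Since x d = 1, d equals x d², a product of `x` and a square.
  inverse-nonNegative : x * d ≈ 1# → 0# ≤ x → 0# ≤ d
  inverse-nonNegative {x} {d} xd≈1 0≤x = begin
    0#           ≤⟨ *-nonNegative 0≤x (square-nonNegative d) ⟩
    x * (d * d)  ≈⟨ *-assoc x d d ⟨
    (x * d) * d  ≈⟨ *-congʳ xd≈1 ⟩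
    1# * d       ≈⟨ *-identityˡ d ⟩
    d            ∎
    where open ≤-Reasoning

  *-cancel-inverse : x * d ≈ 1# → d * (x * y) ≈ y
  *-cancel-inverse {x} {d} {y} xd≈1 = begin
    d * (x * y)  ≈⟨ solve 3 (λ x d y → d :* (x :* y) := x :* d :* y) refl x d y ⟩
    x * d * y    ≈⟨ *-congʳ xd≈1 ⟩
    1# * y       ≈⟨ *-identityˡ y ⟩
    y            ∎
    where open ≈-Reasoning

  *-zero-cancelˡ : ¬ x ≈ 0# → x * y ≈ 0# → y ≈ 0#
  *-zero-cancelˡ {x} {y} x≉0 xy≈0 with inverse x x≉0
  ... | d , xd≈1 = trans (sym (*-cancel-inverse xd≈1)) (trans (*-congˡ xy≈0) (zeroʳ d))

  x-y≈0⇒x≈y : x - y ≈ 0# → x ≈ y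
  x-y≈0⇒x≈y {x} {y} x-y≈0 = begin
    x            ≈⟨ solve 2 (λ x y → x := (x :- y) :+ y) refl x y ⟩
    (x - y) + y  ≈⟨ +-congʳ x-y≈0 ⟩
    0# + y       ≈⟨ +-identityˡ y ⟩
    y            ∎
    where open ≈-Reasoning

  *-cancelʳ-≤ : 0# ≤ z → ¬ z ≈ 0# → x * z ≤ y * z → x ≤ y
  *-cancelʳ-≤ {z} {x} {y} 0≤z z≉0 xz≤yz with inverse z z≉0
  ... | d , zd≈1 = begin
    x            ≈⟨ *-cancel-inverse zd≈1 ⟨
    d * (z * x)  ≈⟨ *-congˡ (*-comm z x) ⟩
    d * (x * z)  ≤⟨ *-monoˡ-≤ (inverse-nonNegative zd≈1 0≤z) xz≤yz ⟩
    d * (y * z)  ≈⟨ *-congˡ (*-comm z y) ⟨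
    d * (z * y)  ≈⟨ *-cancel-inverse zd≈1 ⟩
    y            ∎
    where open ≤-Reasoning

  -- A weak form of the inequality between arithmetic and geometric mean that avoids dividing by 2:
  -- for xy ≥ 0 add xy to (x - y)² ≥ 0, for xy ≤ 0 compare with 0.
  xy≤x²+y² : ∀ x y → x * y ≤ x * x + y * y
  xy≤x²+y² x y with total 0# (x * y)
  ... | inj₁ 0≤xy = 0≤-⇒≤ (≤-trans (+-nonNegative (square-nonNegative (x - y)) 0≤xy)
    (≤-reflexive (solve 2 (λ x y → (x :- y) :* (x :- y) :+ x :* y := x :* x :+ y :* y :- x :* y) refl x y)))
  ... | inj₂ xy≤0 = ≤-trans xy≤0 (+-nonNegative (square-nonNegative x) (square-nonNegative y))

-- Finite sums, the dot product and homogeneous linear systems.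

module LinearAlgebra (ℝ : CompleteOrderedField) where
  open CompleteOrderedField ℝ hiding (zero)
  open OrderedField ℝ
  open Spectral ℝ using (sum; Matrix)
  open SemiringSum semiring public using (sum-cong-≋; ∑-distrib-+; ∑-comm; *-distribˡ-sum; *-distribʳ-sum)

  private variable
    k m n p : ℕ

  sum-zero : {f : Vector Carrier n} → (∀ i → f i ≈ 0#) → sum f ≈ 0#
  sum-zero {zero}  f≈0 = refl
  sum-zero {suc n} f≈0 = trans (+-cong (f≈0 zero) (sum-zero (f≈0 ∘ suc))) (+-identityˡ 0#)

  sum-mono-≤ : {f g : Vector Carrier n} → (∀ i → f i ≤ g i) → sum f ≤ sum g
  sum-mono-≤ {zero}  f≤g = ≤-refl
  sum-mono-≤ {suc n} f≤g = +-mono-≤ (f≤g zero) (sum-mono-≤ (f≤g ∘ suc))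

  sum-nonNegative : {f : Vector Carrier n} → (∀ i → 0# ≤ f i) → 0# ≤ sum f
  sum-nonNegative {zero}  0≤f = ≤-refl
  sum-nonNegative {suc n} 0≤f = +-nonNegative (0≤f zero) (sum-nonNegative (0≤f ∘ suc))

  sum-single : (f : Vector Carrier n) (i : Fin n) → (∀ j → j ≢ i → f j ≈ 0#) → sum f ≈ f i
  sum-single f zero    f≈0 = trans (+-congˡ (sum-zero λ j → f≈0 (suc j) λ ())) (+-identityʳ _)
  sum-single f (suc i) f≈0 =
    trans (+-cong (f≈0 zero λ ()) (sum-single (f ∘ suc) i λ j j≢i → f≈0 (suc j) (j≢i ∘ Finₚ.suc-injective)))
          (+-identityˡ _)

  term≤sum : {f : Vector Carrier n} → (∀ i → 0# ≤ f i) → ∀ i → f i ≤ sum f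
  term≤sum {f = f} 0≤f zero = begin
    f zero                ≈⟨ +-identityʳ _ ⟨
    f zero + 0#           ≤⟨ +-monoʳ-≤ _ (sum-nonNegative (0≤f ∘ suc)) ⟩
    f zero + sum (f ∘ suc) ∎
    where open ≤-Reasoning
  term≤sum {f = f} 0≤f (suc i) = begin
    f (suc i)              ≤⟨ term≤sum (0≤f ∘ suc) i ⟩
    sum (f ∘ suc)          ≈⟨ +-identityˡ _ ⟨
    0# + sum (f ∘ suc)     ≤⟨ +-mono-≤ (0≤f zero) ≤-refl ⟩
    f zero + sum (f ∘ suc) ∎
    where open ≤-Reasoning

  prefix-sum≤sum : {f : Vector Carrier n} (k≤n : k ℕ.≤ n) → (∀ i → 0# ≤ f i) →
                   sum {k} (λ i → f (inject≤ i k≤n)) ≤ sum f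
  prefix-sum≤sum {k = zero}  k≤n         0≤f = sum-nonNegative 0≤f
  prefix-sum≤sum {k = suc k} (ℕ.s≤s k≤n) 0≤f = +-monoʳ-≤ _ (prefix-sum≤sum k≤n (0≤f ∘ suc))

  infixl 7 _·_
  infixl 6 _+ᵛ_
  infixr 7 _*ᵛ_ _*ᴹ_
  infix  4 _≋_

  _≋_ : Vector Carrier n → Vector Carrier n → Set
  x ≋ y = ∀ a → x a ≈ y a

  0ᵛ : Vector Carrier n
  0ᵛ _ = 0#

  _+ᵛ_ : Vector Carrier n → Vector Carrier n → Vector Carrier n
  (x +ᵛ y) a = x a + y a

  _*ᵛ_ : Carrier → Vector Carrier n → Vector Carrier n
  (c *ᵛ x) a = c * x a

  _·_ : Vector Carrier n → Vector Carrier n → Carrier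
  x · y = sum λ a → x a * y a

  _*ᴹ_ : Vector (Vector Carrier n) m → Vector Carrier n → Vector Carrier m
  (M *ᴹ x) a = M a · x

  combination : Vector Carrier p → Vector (Vector Carrier n) p → Vector Carrier n
  combination c w a = sum λ i → c i * w i a

  Symmetric : Matrix n → Set
  Symmetric M = ∀ a b → M a b ≈ M b a

  unit : Fin n → Vector Carrier n
  unit i j with i Fin.≟ j
  ... | yes _ = 1#
  ... | no  _ = 0#

  unit-diag : (i : Fin n) → unit i i ≈ 1#
  unit-diag i with i Fin.≟ i
  ... | yes _   = refl
  ... | no  i≢i = contradiction ≡.refl i≢i

  unit-off : {i j : Fin n} → i ≢ j → unit i j ≈ 0#
  unit-off {i = i} {j} i≢j with i Fin.≟ j
  ... | yes i≡j = contradiction i≡j i≢j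
  ... | no  _   = refl

  unit-· : (i : Fin n) (x : Vector Carrier n) → unit i · x ≈ x i
  unit-· i x = begin
    unit i · x       ≈⟨ sum-single _ i (λ j j≢i → trans (*-congʳ (unit-off (j≢i ∘ ≡.sym))) (zeroˡ _)) ⟩
    unit i i * x i   ≈⟨ *-congʳ (unit-diag i) ⟩
    1# * x i         ≈⟨ *-identityˡ _ ⟩
    x i              ∎
    where open ≈-Reasoning

  ·-cong : {x y z w : Vector Carrier n} → x ≋ y → z ≋ w → x · z ≈ y · w
  ·-cong x≋y z≋w = sum-cong-≋ λ a → *-cong (x≋y a) (z≋w a)

  ·-congˡ : (x : Vector Carrier n) {y z : Vector Carrier n} → y ≋ z → x · y ≈ x · z
  ·-congˡ x = ·-cong {x = x} λ _ → refl

  ·-congʳ : {x y : Vector Carrier n} (z : Vector Carrier n) → x ≋ y → x · z ≈ y · z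
  ·-congʳ z x≋y = ·-cong {z = z} x≋y λ _ → refl

  ·-comm : (x y : Vector Carrier n) → x · y ≈ y · x
  ·-comm x y = sum-cong-≋ λ a → *-comm (x a) (y a)

  ·-+ᵛ : (x y z : Vector Carrier n) → x · (y +ᵛ z) ≈ x · y + x · z
  ·-+ᵛ {n} x y z = trans (sum-cong-≋ λ a → distribˡ (x a) (y a) (z a)) (∑-distrib-+ {n} _ _)

  ·-*ᵛ : ∀ c (x y : Vector Carrier n) → x · (c *ᵛ y) ≈ c * (x · y)
  ·-*ᵛ {n} c x y = trans (sum-cong-≋ λ a → solve 3 (λ x c y → x :* (c :* y) := c :* (x :* y)) refl (x a) c (y a))
                     (sym (*-distribˡ-sum {n} c _))

  +ᵛ-· : (x y z : Vector Carrier n) → (x +ᵛ y) · z ≈ x · z + y · z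
  +ᵛ-· x y z = trans (·-comm (x +ᵛ y) z) (trans (·-+ᵛ z x y) (+-cong (·-comm z x) (·-comm z y)))

  *ᵛ-· : ∀ c (x y : Vector Carrier n) → (c *ᵛ x) · y ≈ c * (x · y)
  *ᵛ-· c x y = trans (·-comm (c *ᵛ x) y) (trans (·-*ᵛ c y x) (*-congˡ (·-comm y x)))

  ·-combination : (x : Vector Carrier n) (c : Vector Carrier p) (w : Vector (Vector Carrier n) p) →
                  x · combination c w ≈ sum λ i → c i * (x · w i)
  ·-combination {n = n} {p = p} x c w = begin
    sum (λ a → x a * sum λ i → c i * w i a)     ≈⟨ sum-cong-≋ (λ a → *-distribˡ-sum {p} (x a) _) ⟩
    sum (λ a → sum λ i → x a * (c i * w i a))   ≈⟨ ∑-comm {n} {p} _ ⟩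
    sum (λ i → x · (c i *ᵛ w i))                ≈⟨ sum-cong-≋ (λ i → ·-*ᵛ (c i) x (w i)) ⟩
    sum (λ i → c i * (x · w i))                 ∎
    where open ≈-Reasoning

  ·-zeroʳ : (x : Vector Carrier n) → x · 0ᵛ ≈ 0#
  ·-zeroʳ x = sum-zero λ a → zeroʳ (x a)

  ·-nonNegative : (x : Vector Carrier n) → 0# ≤ x · x
  ·-nonNegative x = sum-nonNegative λ a → square-nonNegative (x a)

  ·-definite : {x : Vector Carrier n} → x · x ≈ 0# → x ≋ 0ᵛ
  ·-definite {x = x} x·x≈0 a with x a ≟ 0#
  ... | yes xₐ≈0 = xₐ≈0
  ... | no  xₐ≉0 = *-zero-cancelˡ xₐ≉0
    (antisym (≤-trans (term≤sum (λ b → square-nonNegative (x b)) a) (≤-reflexive x·x≈0)) (square-nonNegative (x a)))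

  ·-self-adjoint : (M : Matrix n) → Symmetric M → ∀ x y → x · (M *ᴹ y) ≈ (M *ᴹ x) · y
  ·-self-adjoint {n} M M-sym x y = begin
    sum (λ a → x a * (M a · y))                ≈⟨ sum-cong-≋ (λ a → *-distribˡ-sum {n} (x a) _) ⟩
    sum (λ a → sum λ b → x a * (M a b * y b))  ≈⟨ ∑-comm {n} {n} _ ⟩
    sum (λ b → sum λ a → x a * (M a b * y b))  ≈⟨ sum-cong-≋ (λ b → sum-cong-≋ λ a →
                                                   trans (*-congˡ (*-congʳ (M-sym a b)))
                                                         (solve 3 (λ x m y → x :* (m :* y)
                                                               := m :* x :* y) refl (x a) (M b a) (y b))) ⟩
    sum (λ b → sum λ a → M b a * x a * y b)    ≈⟨ sum-cong-≋ (λ b → *-distribʳ-sum {n} (y b) _) ⟨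
    sum (λ b → (M b · x) * y b)                ∎
    where open ≈-Reasoning

  sum-assoc-· : (M : Vector (Vector Carrier n) m) (c : Vector Carrier m) (x : Vector Carrier n) →
                combination c M · x ≈ c · (M *ᴹ x)
  sum-assoc-· M c x = trans (·-comm (combination c M) x)
    (trans (·-combination x c M) (sum-cong-≋ λ i → *-congˡ (·-comm x (M i))))

  -- Gaussian elimination of the unknown 0: its column either vanishes, so that
  -- unit 0 is a solution, or has a pivot in some row i.
  homogeneous-solution : m ℕ.< n → (A : Vector (Vector Carrier n) m) →
                         ∃ λ x → ¬ x ≋ 0ᵛ × A *ᴹ x ≋ 0ᵛ
  homogeneous-solution {zero}  {suc n} _           A = (λ _ → 1#) , (λ 1≋0 → 0≉1 (sym (1≋0 zero))) , λ ()
  homogeneous-solution {suc m} {suc n} (ℕ.s≤s m<n) A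
    with Finₚ.any? (λ i → ¬? (A i zero ≟ 0#))
  ... | no column≈0 = unit zero , (λ u≋0 → 0≉1 (sym (u≋0 zero)))
    , λ i → trans (·-comm (A i) (unit zero)) (trans (unit-· zero (A i))
        (decidable-stable (A i zero ≟ 0#) λ Aᵢ₀≉0 → column≈0 (i , Aᵢ₀≉0)))
  ... | yes (i , Aᵢ₀≉0) with inverse (A i zero) Aᵢ₀≉0
  ... | d , Aᵢ₀d≈1 with homogeneous-solution m<n
    (λ r j → A (punchIn i r) (suc j) + - (A (punchIn i r) zero * d) * A i (suc j))
  ... | y , y≉0 , reduced = x , (λ x≋0 → y≉0 (x≋0 ∘ suc)) , solves
    where
    open ≈-Reasoning
    pivotRow = Vec.tail (A i)
    s = pivotRow · y

    x : Vector Carrier (suc n)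
    -- Back substitution: this value of the unknown 0 solves the pivot row, and `y` solves the other
    -- rows after elimination.
    x = (- (d * s)) Vec.∷ y

    solves : A *ᴹ x ≋ 0ᵛ
    solves r with i Fin.≟ r
    ... | yes ≡.refl = begin
      A i zero * - (d * s) + s
        ≈⟨ solve 3 (λ a d s → a :* (:- (d :* s)) :+ s := (con (+ 1) :- a :* d) :* s) refl (A i zero) d s ⟩
      (1# - A i zero * d) * s        ≈⟨ *-congʳ (+-congˡ (-‿cong Aᵢ₀d≈1)) ⟩
      (1# - 1#) * s                  ≈⟨ *-congʳ (-‿inverseʳ 1#) ⟩
      0# * s                         ≈⟨ zeroˡ s ⟩
      0#                             ∎
    ... | no i≢r = ≡.subst (λ r → A r · x ≈ 0#) (Finₚ.punchIn-punchOut i≢r) (begin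
      R zero * - (d * s) + Vec.tail R · y
        ≈⟨ solve 4 (λ a d s t → a :* (:- (d :* s)) :+ t := t :+ (:- (a :* d)) :* s) refl (R zero) d s (Vec.tail R · y) ⟩
      Vec.tail R · y + - (R zero * d) * s            ≈⟨ +-congˡ (*ᵛ-· (- (R zero * d)) pivotRow y) ⟨
      Vec.tail R · y + (- (R zero * d) *ᵛ pivotRow) · y ≈⟨ +ᵛ-· (Vec.tail R) (- (R zero * d) *ᵛ pivotRow) y ⟨
      (Vec.tail R +ᵛ - (R zero * d) *ᵛ pivotRow) · y ≈⟨ reduced (punchOut i≢r) ⟩
      0#                                             ∎)
      where R = A (punchIn i (punchOut i≢r))

-- Existence of a bottom eigenvector of a symmetric matrix.

module RayleighQuotient (ℝ : CompleteOrderedField) where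
  open CompleteOrderedField ℝ hiding (zero)
  open OrderedField ℝ
  open LinearAlgebra ℝ
  open Spectral ℝ using (sum; Matrix)

  private variable
    n : ℕ

  quadratic : Matrix n → Vector Carrier n → Carrier
  quadratic M v = v · (M *ᴹ v)

  IsFormLowerBound : Matrix n → Carrier → Set
  IsFormLowerBound M t = ∀ v → t * (v · v) ≤ quadratic M v

  -- A deliberately crude bound of the Rayleigh quotient: v_a M_ab v_b ≤ v_a² + M_ab² v_b² ≤ (1 +
  -- M_ab²) |v|² for each entry. Only its being finite matters.
  quadraticBound : Matrix n → Carrier
  quadraticBound M = sum λ a → sum λ b → 1# + M a b * M a b

  quadratic-bounded : (M : Matrix n) → ∀ v → quadratic M v ≤ quadraticBound M * (v · v)
  quadratic-bounded {n} M v = begin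
    sum (λ a → v a * (M a · v))                                    ≈⟨ sum-cong-≋ (λ a → *-distribˡ-sum {n} (v a) _) ⟩
    sum (λ a → sum λ b → v a * (M a b * v b))                      ≤⟨ sum-mono-≤ (λ a → sum-mono-≤ (entry a)) ⟩
    sum (λ a → sum λ b → (1# + M a b * M a b) * (v · v))
      ≈⟨ sum-cong-≋ {n} (λ a → *-distribʳ-sum {n} (v · v) _) ⟨
    sum (λ a → (sum λ b → 1# + M a b * M a b) * (v · v))           ≈⟨ *-distribʳ-sum {n} (v · v) _ ⟨
    quadraticBound M * (v · v)                                     ∎
    where
    open ≤-Reasoning
    v²≤v·v : ∀ a → v a * v a ≤ v · v
    v²≤v·v = term≤sum λ a → square-nonNegative (v a)
    entry : ∀ a b → v a * (M a b * v b) ≤ (1# + M a b * M a b) * (v · v)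
    entry a b = begin
      v a * (M a b * v b)                              ≤⟨ xy≤x²+y² (v a) (M a b * v b) ⟩
      v a * v a + M a b * v b * (M a b * v b)
        ≈⟨ +-congˡ (solve 2 (λ m y → m :* y :* (m :* y) := m :* m :* (y :* y)) refl (M a b) (v b)) ⟩
      v a * v a + M a b * M a b * (v b * v b)
        ≤⟨ +-mono-≤ (v²≤v·v a) (*-monoˡ-≤ (square-nonNegative (M a b)) (v²≤v·v b)) ⟩
      v · v + M a b * M a b * (v · v)
        ≈⟨ solve 2 (λ s r → s :+ r :* s := (con (+ 1) :+ r) :* s) refl (v · v) (M a b * M a b) ⟩
      (1# + M a b * M a b) * (v · v)                   ∎

  -- The upper bound for -M, negated. It makes the set inhabited whose supremum is the bottom
  -- eigenvalue.
  quadratic-bounded-below : (M : Matrix n) → ∃ (IsFormLowerBound M)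
  quadratic-bounded-below {n} M = - quadraticBound negM , λ v → 0≤-⇒≤ (begin
    0#                                                      ≤⟨ ≤⇒0≤- (quadratic-bounded negM v) ⟩
    quadraticBound negM * (v · v) - quadratic negM v        ≈⟨ +-congˡ (-‿cong (quadratic-neg v)) ⟩
    quadraticBound negM * (v · v) - (- 1#) * quadratic M v
      ≈⟨ solve 3 (λ c s q → c :* s :- (:- con (+ 1)) :* q
            := q :- (:- c) :* s) refl (quadraticBound negM) (v · v) (quadratic M v) ⟩
    quadratic M v - (- quadraticBound negM) * (v · v)       ∎)
    where
    open ≤-Reasoning
    negM : Matrix n
    negM a = (- 1#) *ᵛ M a
    quadratic-neg : ∀ v → quadratic negM v ≈ (- 1#) * quadratic M v
    quadratic-neg v = trans (·-congˡ v λ a → *ᵛ-· (- 1#) (M a) v) (·-*ᵛ (- 1#) v (M *ᴹ v))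

  -- The augmented matrix with columns `unit i` and R has one more column than rows, hence a nonzero
  -- kernel vector x. If x₀ = 0, its tail lies in the kernel of R; otherwise -1/x₀ times the tail is
  -- a preimage of `unit i`.
  kernel⊎preimage : (R : Matrix n) (i : Fin n) →
                    (∃ λ v → ¬ v ≋ 0ᵛ × R *ᴹ v ≋ 0ᵛ) ⊎ (∃ λ y → R *ᴹ y ≋ unit i)
  kernel⊎preimage {n} R i with homogeneous-solution (ℕₚ.n<1+n n) (λ a → unit i a Vec.∷ R a)
  ... | x , x≉0 , solves with x zero ≟ 0#
  ... | yes x₀≈0 = inj₁ (Vec.tail x , (λ t≋0 → x≉0 λ { zero → x₀≈0 ; (suc a) → t≋0 a }) , λ a → begin
    R a · Vec.tail x                                 ≈⟨ +-identityˡ _ ⟨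
    0# + R a · Vec.tail x                            ≈⟨ +-congʳ (trans (*-congˡ x₀≈0) (zeroʳ (unit i a))) ⟨
    unit i a * x zero + R a · Vec.tail x             ≈⟨ solves a ⟩
    0#                                               ∎)
    where open ≈-Reasoning
  ... | no x₀≉0 with inverse (x zero) x₀≉0
  ... | d , x₀d≈1 = inj₂ ((- d) *ᵛ Vec.tail x , λ a → x-y≈0⇒x≈y (begin
    R a · ((- d) *ᵛ Vec.tail x) - unit i a
      ≈⟨ +-cong (·-*ᵛ (- d) (R a) (Vec.tail x)) (-‿cong (sym (*-cancel-inverse x₀d≈1))) ⟩
    (- d) * (R a · Vec.tail x) - d * (x zero * unit i a)
      ≈⟨ solve 4 (λ d r x u → (:- d) :* r :- d :* (x :* u)
            := (:- d) :* (u :* x :+ r)) refl d (R a · Vec.tail x) (x zero) (unit i a) ⟩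
    (- d) * (unit i a * x zero + R a · Vec.tail x)   ≈⟨ *-congˡ (solves a) ⟩
    (- d) * 0#                                       ≈⟨ zeroʳ (- d) ⟩
    0#                                               ∎))
    where open ≈-Reasoning

  -- Evaluate the form on (1 + y i) v - (v i) y: since y i is its value at y, this is
  -- nearly its minimum on a line through v, and the 1 keeps the factor positive.
  coordinate-bound : (R : Matrix n) → Symmetric R → (∀ v → 0# ≤ quadratic R v) →
                     ∀ {i y} → R *ᴹ y ≋ unit i → ∀ v → v i * v i ≤ (y i + 1#) * quadratic R v
  coordinate-bound R R-sym R-psd {i} {y} Ry≋uᵢ v =
    *-cancelʳ-≤ 0≤D D≉0 (0≤-⇒≤ (begin
      0#                                  ≤⟨ +-nonNegative (R-psd z) (square-nonNegative (v i)) ⟩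
      quadratic R z + v i * v i           ≈⟨ +-congʳ ρz ⟩
      -- The added square turns v_i² y_i into v_i² D, so the whole expression is D (D ρ - v_i²), and
      -- D > 0 can be cancelled.
      D * D * ρ - (1# + 1#) * D * (v i * v i) + v i * v i * y i + v i * v i
                                          ≈⟨ solve 3 (λ r ρ v → (r :+ con (+ 1)) :* (r :+ con (+ 1)) :* ρ :- (con (+ 1) :+ con (+ 1)) :* (r :+ con (+ 1)) :* (v :* v) :+ v :* v :* r :+ v :* v
                                                              
                                                                     := (r :+ con (+ 1)) :* ρ :* (r :+ con (+ 1)) :- v :* v :* (r :+ con (+ 1)))
                                                                     refl (y i) ρ (v i) ⟩
      D * ρ * D - v i * v i * D           ∎))
    where
    open ≤-Reasoning
    D = y i + 1#
    ρ = quadratic R v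
    z = D *ᵛ v +ᵛ (- v i) *ᵛ y

    ·Ry : ∀ x → x · (R *ᴹ y) ≈ x i
    ·Ry x = trans (·-congˡ x Ry≋uᵢ) (trans (·-comm x (unit i)) (unit-· i x))

    0≤yᵢ : 0# ≤ y i
    0≤yᵢ = ≤-trans (R-psd y) (≤-reflexive (·Ry y))

    0≤D : 0# ≤ D
    0≤D = +-nonNegative 0≤yᵢ 0≤1

    D≉0 : ¬ D ≈ 0#
    D≉0 D≈0 = 1≰0 (begin
      1#        ≈⟨ +-identityˡ 1# ⟨
      0# + 1#   ≤⟨ +-mono-≤ 0≤yᵢ ≤-refl ⟩
      D         ≈⟨ D≈0 ⟩
      0#        ∎)

    ·Rz : ∀ x → x · (R *ᴹ z) ≈ D * (x · (R *ᴹ v)) + (- v i) * x i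
    ·Rz x = begin-equality
      x · (R *ᴹ z)
        ≈⟨ ·-congˡ x (λ a → trans (·-+ᵛ (R a) (D *ᵛ v) ((- v i) *ᵛ y)) (+-cong (·-*ᵛ D (R a) v) (·-*ᵛ (- v i) (R a) y))) ⟩
      x · (D *ᵛ (R *ᴹ v) +ᵛ (- v i) *ᵛ (R *ᴹ y))       ≈⟨ ·-+ᵛ x (D *ᵛ (R *ᴹ v)) ((- v i) *ᵛ (R *ᴹ y)) ⟩
      x · (D *ᵛ (R *ᴹ v)) + x · ((- v i) *ᵛ (R *ᴹ y))
        ≈⟨ +-cong (·-*ᵛ D x (R *ᴹ v)) (trans (·-*ᵛ (- v i) x (R *ᴹ y)) (*-congˡ (·Ry x))) ⟩
      D * (x · (R *ᴹ v)) + (- v i) * x i               ∎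

    z·Rv : z · (R *ᴹ v) ≈ D * ρ + (- v i) * v i
    z·Rv = begin-equality
      z · (R *ᴹ v)                                     ≈⟨ +ᵛ-· (D *ᵛ v) ((- v i) *ᵛ y) (R *ᴹ v) ⟩
      (D *ᵛ v) · (R *ᴹ v) + ((- v i) *ᵛ y) · (R *ᴹ v)  ≈⟨ +-cong (*ᵛ-· D v (R *ᴹ v)) (*ᵛ-· (- v i) y (R *ᴹ v)) ⟩
      D * ρ + (- v i) * (y · (R *ᴹ v))
        ≈⟨ +-congˡ (*-congˡ (trans (·-self-adjoint R R-sym y v) (trans (·-comm (R *ᴹ y) v) (·Ry v)))) ⟩
      D * ρ + (- v i) * v i                            ∎

    ρz : quadratic R z ≈ D * D * ρ - (1# + 1#) * D * (v i * v i) + v i * v i * y i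
    ρz = begin-equality
      z · (R *ᴹ z)                                     ≈⟨ ·Rz z ⟩
      D * (z · (R *ᴹ v)) + (- v i) * z i               ≈⟨ +-congʳ (*-congˡ z·Rv) ⟩
      D * (D * ρ + (- v i) * v i) + (- v i) * (D * v i + (- v i) * y i)
        ≈⟨ solve 4 (λ D ρ v y → D :* (D :* ρ :+ (:- v) :* v) :+ (:- v) :* (D :* v :+ (:- v) :* y)
                             
                                    := D :* D :* ρ :- (con (+ 1) :+ con (+ 1)) :* D :* (v :* v) :+ v :* v :* y)
                                    refl D ρ (v i) (y i) ⟩
      D * D * ρ - (1# + 1#) * D * (v i * v i) + v i * v i * y i  ∎

  -- Adding the coordinate bounds over all i gives |v|² ≤ C ρ(v), where C is the sum of the factors
  -- and ρ the form of R; hence ε = 1/C. There is at least one coordinate and every factor is at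
  -- least 1, so C is invertible.
  coercive : (R : Matrix (suc n)) → Symmetric R → (∀ v → 0# ≤ quadratic R v) →
             (∀ i → ∃ λ y → R *ᴹ y ≋ unit i) →
             ∃ λ ε → ¬ ε ≤ 0# × (∀ v → ε * (v · v) ≤ quadratic R v)
  coercive {n} R R-sym R-psd preimage = ε , ε≰0 , bound
    where
    open ≤-Reasoning
    y : Matrix (suc n)
    y i = proj₁ (preimage i)

    D : Vector Carrier (suc n)
    D i = y i i + 1#

    1≤D : ∀ i → 1# ≤ D i
    1≤D i = begin
      1#       ≈⟨ +-identityˡ 1# ⟨
      0# + 1#  ≤⟨ +-mono-≤ 0≤yᵢᵢ ≤-refl ⟩
      D i      ∎
      where
      0≤yᵢᵢ : 0# ≤ y i i
      0≤yᵢᵢ = begin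
        0#                  ≤⟨ R-psd (y i) ⟩
        y i · (R *ᴹ y i)    ≈⟨ ·-congˡ (y i) (proj₂ (preimage i)) ⟩
        y i · unit i        ≈⟨ trans (·-comm (y i) (unit i)) (unit-· i (y i)) ⟩
        y i i               ∎

    C = sum D

    1≤C : 1# ≤ C
    1≤C = ≤-trans (1≤D zero) (term≤sum (λ i → ≤-trans 0≤1 (1≤D i)) zero)

    C⁻¹ = inverse C λ C≈0 → 1≰0 (≤-trans 1≤C (≤-reflexive C≈0))
    ε = proj₁ C⁻¹

    0≤ε : 0# ≤ ε
    0≤ε = inverse-nonNegative (proj₂ C⁻¹) (≤-trans 0≤1 1≤C)

    ε≰0 : ¬ ε ≤ 0#
    ε≰0 ε≤0 = 0≉1 (begin-equality
      0#       ≈⟨ zeroʳ C ⟨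
      C * 0#   ≈⟨ *-congˡ (antisym 0≤ε ε≤0) ⟩
      C * ε    ≈⟨ proj₂ C⁻¹ ⟩
      1#       ∎)

    bound : ∀ v → ε * (v · v) ≤ quadratic R v
    bound v = begin
      ε * (v · v)
        ≤⟨ *-monoˡ-≤ 0≤ε (sum-mono-≤ λ i → coordinate-bound R R-sym R-psd {i} {y i} (proj₂ (preimage i)) v) ⟩
      ε * sum (λ i → D i * quadratic R v)      ≈⟨ *-congˡ (*-distribʳ-sum {suc n} (quadratic R v) D) ⟨
      ε * (C * quadratic R v)                  ≈⟨ *-cancel-inverse (proj₂ C⁻¹) ⟩
      quadratic R v                            ∎

  unit-sym : (i j : Fin n) → unit i j ≈ unit j i
  unit-sym i j with i Fin.≟ j
  ... | yes ≡.refl = sym (unit-diag i)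
  ... | no  i≢j    = sym (unit-off (i≢j ∘ ≡.sym))

  -- The Rayleigh quotient of each nonzero v is an upper bound of the set of lower bounds, so the
  -- least upper bound s does not exceed it. Thus the supremum belongs to the set.
  supremum-IsFormLowerBound : (M : Matrix n) → ∀ s → (∀ b → IsUpperBound (IsFormLowerBound M) b → s ≤ b) →
                              IsFormLowerBound M s
  supremum-IsFormLowerBound M s s-least v with v · v ≟ 0#
  ... | yes vv≈0 = ≤-reflexive (begin
    s * (v · v)     ≈⟨ *-congˡ vv≈0 ⟩
    s * 0#          ≈⟨ zeroʳ s ⟩
    0#              ≈⟨ ·-zeroʳ (M *ᴹ v) ⟨
    (M *ᴹ v) · 0ᵛ   ≈⟨ ·-congˡ (M *ᴹ v) (·-definite vv≈0) ⟨
    (M *ᴹ v) · v    ≈⟨ ·-comm (M *ᴹ v) v ⟩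
    quadratic M v   ∎)
    where open ≈-Reasoning
  ... | no vv≉0 with inverse (v · v) vv≉0
  ... | d , vvd≈1 = begin
    s * (v · v)                    ≤⟨ *-monoʳ-≤ (·-nonNegative v) (s-least (d * quadratic M v) upper) ⟩
    d * quadratic M v * (v · v)    ≈⟨ cancel ⟩
    quadratic M v                  ∎
    where
    open ≤-Reasoning
    cancel : d * quadratic M v * (v · v) ≈ quadratic M v
    cancel = trans (solve 3 (λ d q x → d :* q :* x := d :* (x :* q)) refl d (quadratic M v) (v · v))
                   (*-cancel-inverse vvd≈1)

    upper : IsUpperBound (IsFormLowerBound M) (d * quadratic M v)
    upper t t-lower = *-cancelʳ-≤ (·-nonNegative v) vv≉0 (≤-trans (t-lower v) (≤-reflexive (sym cancel)))

  -- If M - s were invertible it would be coercive, and s could be enlarged.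
  greatest-lower-bound-eigenvalue :
    (M : Matrix (suc n)) → Symmetric M → ∀ s → IsFormLowerBound M s → (∀ t → IsFormLowerBound M t → t ≤ s) →
    ∃ λ w → ¬ w ≋ 0ᵛ × M *ᴹ w ≋ s *ᵛ w
  greatest-lower-bound-eigenvalue {n} M M-sym s s-lower s-greatest =
    -- Sequencing in the sum applicative exchanges the quantifier with the alternative: either some
    -- i yields a kernel vector, or all unit vectors have preimages.
    conclude (Finₚ.sequence (Sumₗ.applicative (∃ λ v → ¬ v ≋ 0ᵛ × R *ᴹ v ≋ 0ᵛ) 0ℓ) (kernel⊎preimage R))
    where
    open ≤-Reasoning
    R : Matrix (suc n)
    R a = M a +ᵛ (- s) *ᵛ unit a

    R-sym : Symmetric R
    R-sym a b = +-cong (M-sym a b) (*-congˡ (unit-sym a b))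

    R*ᴹ : ∀ v → R *ᴹ v ≋ M *ᴹ v +ᵛ (- s) *ᵛ v
    R*ᴹ v a = trans (+ᵛ-· (M a) ((- s) *ᵛ unit a) v) (+-congˡ (trans (*ᵛ-· (- s) (unit a) v) (*-congˡ (unit-· a v))))

    quadratic-R : ∀ v → quadratic R v ≈ quadratic M v - s * (v · v)
    quadratic-R v = begin-equality
      v · (R *ᴹ v)                              ≈⟨ ·-congˡ v (R*ᴹ v) ⟩
      v · (M *ᴹ v +ᵛ (- s) *ᵛ v)                ≈⟨ ·-+ᵛ v (M *ᴹ v) ((- s) *ᵛ v) ⟩
      v · (M *ᴹ v) + v · ((- s) *ᵛ v)           ≈⟨ +-congˡ (·-*ᵛ (- s) v v) ⟩
      quadratic M v + (- s) * (v · v)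
        ≈⟨ solve 3 (λ q s x → q :+ (:- s) :* x := q :- s :* x) refl (quadratic M v) s (v · v) ⟩
      quadratic M v - s * (v · v)               ∎

    R-psd : ∀ v → 0# ≤ quadratic R v
    R-psd v = ≤-trans (≤⇒0≤- (s-lower v)) (≤-reflexive (sym (quadratic-R v)))

    not-coercive : ¬ ∃ λ ε → ¬ ε ≤ 0# × (∀ v → ε * (v · v) ≤ quadratic R v)
    not-coercive (ε , ε≰0 , ε-lower) = ε≰0 (0≤-⇒≤ (begin
      0#               ≤⟨ ≤⇒0≤- (s-greatest (s + ε) s+ε-lower) ⟩
      s - (s + ε)      ≈⟨ solve 2 (λ s e → s :- (s :+ e) := con (+ 0) :- e) refl s ε ⟩
      0# - ε           ∎))
      where
      s+ε-lower : IsFormLowerBound M (s + ε)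
      s+ε-lower v = 0≤-⇒≤ (begin
        0#                                            ≤⟨ ≤⇒0≤- (ε-lower v) ⟩
        quadratic R v - ε * (v · v)                   ≈⟨ +-congʳ (quadratic-R v) ⟩
        quadratic M v - s * (v · v) - ε * (v · v)
          ≈⟨ solve 4 (λ q s e x → q :- s :* x :- e :* x := q :- (s :+ e) :* x) refl (quadratic M v) s ε (v · v) ⟩
        quadratic M v - (s + ε) * (v · v)             ∎)

    conclude : (∃ λ v → ¬ v ≋ 0ᵛ × R *ᴹ v ≋ 0ᵛ) ⊎ (∀ i → ∃ λ y → R *ᴹ y ≋ unit i) →
               ∃ λ w → ¬ w ≋ 0ᵛ × M *ᴹ w ≋ s *ᵛ w
    conclude (inj₁ (w , w≉0 , Rw≋0)) = w , w≉0 , λ a → x-y≈0⇒x≈y (begin-equality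
      (M *ᴹ w) a - s * w a         ≈⟨ solve 3 (λ q s x → q :- s :* x := q :+ (:- s) :* x) refl ((M *ᴹ w) a) s (w a) ⟩
      (M *ᴹ w) a + (- s) * w a     ≈⟨ R*ᴹ w a ⟨
      (R *ᴹ w) a                   ≈⟨ Rw≋0 a ⟩
      0#                           ∎)
    conclude (inj₂ preimage) = contradiction (coercive R R-sym R-psd preimage) not-coercive

  bottom-eigenpair : (M : Matrix (suc n)) → Symmetric M →
                     ∃₂ λ s w → ¬ w ≋ 0ᵛ × M *ᴹ w ≋ s *ᵛ w × IsFormLowerBound M s
  bottom-eigenpair {n} M M-sym =
    let s , s-upper , s-least = supremum (IsFormLowerBound M) (quadratic-bounded-below M) (quadratic M e₀ , bounded)
        s-lower = supremum-IsFormLowerBound M s s-least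
        w , w≉0 , Mw≋sw = greatest-lower-bound-eigenvalue M M-sym s s-lower s-upper
    in s , w , w≉0 , Mw≋sw , s-lower
    where
    open ≤-Reasoning
    e₀ : Vector Carrier (suc n)
    e₀ = unit zero

    -- A single test vector of norm 1 bounds all form lower bounds.
    bounded : IsUpperBound (IsFormLowerBound M) (quadratic M e₀)
    bounded t t-lower = begin
      t              ≈⟨ *-identityʳ t ⟨
      t * 1#         ≈⟨ *-congˡ (unit-· zero e₀) ⟨
      t * (e₀ · e₀)  ≤⟨ t-lower e₀ ⟩
      quadratic M e₀ ∎

-- Orthogonal eigenbases by deflation.

module SpectralTheorem (ℝ : CompleteOrderedField) where
  open CompleteOrderedField ℝ hiding (zero)
  open OrderedField ℝ
  open LinearAlgebra ℝ
  open RayleighQuotient ℝ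
  open Spectral ℝ using (sum; Matrix)

  private variable
    n p : ℕ

  -- `weight` is 1/|v|²: it replaces normalisation, which would require square roots, and its
  -- existence forces the vectors to be nonzero.
  record OrthogonalEigenvectors (A : Matrix n) (p : ℕ) : Set where
    field
      eigenvalue : Vector Carrier p
      vec        : Vector (Vector Carrier n) p
      weight     : Vector Carrier p
      normalised : ∀ i → (vec i · vec i) * weight i ≈ 1#
      orthogonal : ∀ {i j} → i ≢ j → vec i · vec j ≈ 0#
      eigen      : ∀ i → A *ᴹ vec i ≋ eigenvalue i *ᵛ vec i
      sorted     : ∀ i j → i Fin.≤ j → eigenvalue j ≤ eigenvalue i

    weight-nonNegative : ∀ i → 0# ≤ weight i
    weight-nonNegative i = inverse-nonNegative (normalised i) (·-nonNegative (vec i))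

    norm≉0 : ∀ i → ¬ vec i · vec i ≈ 0#
    norm≉0 i norm≈0 = 0≉1 (trans (sym (trans (*-congʳ norm≈0) (zeroˡ (weight i)))) (normalised i))

    IsOrthogonalTo : Vector Carrier n → Set
    IsOrthogonalTo v = ∀ i → vec i · v ≈ 0#

  open OrthogonalEigenvectors

  -- The invariant of the induction: the eigenvalues found so far are the smallest ones, so a new
  -- eigenvector orthogonal to `E` can be put in front without breaking `sorted`.
  IsBottom : {A : Matrix n} → OrthogonalEigenvectors A p → Set
  IsBottom {A = A} E = ∀ v → IsOrthogonalTo E v → ∀ i → eigenvalue E i * (v · v) ≤ quadratic A v

  -- Deflation: M agrees with A on the orthogonal complement of E and maps
  -- each vector w of E to (C + 1) w, where C is an upper bound of the
  -- Rayleigh quotient of A.  Hence a bottom eigenvector of M is orthogonal to E.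
  module Deflation {n p} (A : Matrix n) (A-sym : Symmetric A) (E : OrthogonalEigenvectors A p) where
    C : Carrier
    C = quadraticBound A

    shift : Vector Carrier p
    shift i = (C + 1# - eigenvalue E i) * weight E i

    M : Matrix n
    M a = A a +ᵛ combination (λ i → shift i * vec E i a) (vec E)

    M-sym : Symmetric M
    M-sym a b = +-cong (A-sym a b) (sum-cong-≋ λ i →
      solve 3 (λ s x y → s :* x :* y := s :* y :* x) refl (shift i) (vec E i a) (vec E i b))

    M*ᴹ : ∀ v a → (M *ᴹ v) a ≈ (A *ᴹ v) a + sum λ i → shift i * vec E i a * (vec E i · v)
    M*ᴹ v a = trans (+ᵛ-· (A a) (combination (λ i → shift i * vec E i a) (vec E)) v)
                    (+-congˡ (sum-assoc-· (vec E) (λ i → shift i * vec E i a) v))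

    M-orthogonal : ∀ v → IsOrthogonalTo E v → M *ᴹ v ≋ A *ᴹ v
    M-orthogonal v v⊥E a = trans (M*ᴹ v a)
      (trans (+-congˡ (sum-zero λ i → trans (*-congˡ (v⊥E i)) (zeroʳ _))) (+-identityʳ _))

    M-vec : ∀ j → M *ᴹ vec E j ≋ (C + 1#) *ᵛ vec E j
    M-vec j a = begin
      (M *ᴹ w) a                                                    ≈⟨ M*ᴹ w a ⟩
      (A *ᴹ w) a + sum (λ i → shift i * vec E i a * (vec E i · w))
        ≈⟨ +-cong (eigen E j a) (sum-single _ j λ i i≢j → trans (*-congˡ (orthogonal E i≢j)) (zeroʳ _)) ⟩
      μ * w a + (C + 1# - μ) * weight E j * w a * (w · w)
        ≈⟨ solve 5 (λ c μ d x r → μ :* x :+ (c :- μ) :* d :* x :* r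
              := μ :* x :+ (c :- μ) :* x :* (r :* d)) refl (C + 1#) μ (weight E j) (w a) (w · w) ⟩
      μ * w a + (C + 1# - μ) * w a * ((w · w) * weight E j)         ≈⟨ +-congˡ (*-congˡ (normalised E j)) ⟩
      μ * w a + (C + 1# - μ) * w a * 1#
        ≈⟨ solve 3 (λ c μ x → μ :* x :+ (c :- μ) :* x :* con (+ 1) := c :* x) refl (C + 1#) μ (w a) ⟩
      (C + 1#) * w a                                                ∎
      where
      open ≈-Reasoning
      w = vec E j
      μ = eigenvalue E j

    -- As p < n, some nonzero u is orthogonal to `E`. There `M` agrees with `A`, so s is at most the
    -- Rayleigh quotient of u, which is at most `C`. The vectors of `E` have the different
    -- eigenvalue C + 1 under the symmetric `M`, hence are orthogonal to w.
    bottom-orthogonal : p ℕ.< n → ∀ {s w} → M *ᴹ w ≋ s *ᵛ w → IsFormLowerBound M s → IsOrthogonalTo E w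
    bottom-orthogonal p<n {s} {w} Mw≋sw s-lower j with homogeneous-solution p<n (vec E)
    ... | u , u≉0 , u⊥E = *-zero-cancelˡ gap≉0 (begin-equality
      (C + 1# - s) * (x · w)
        ≈⟨ solve 3 (λ c s y → (c :- s) :* y := c :* y :- s :* y) refl (C + 1#) s (x · w) ⟩
      (C + 1#) * (x · w) - s * (x · w)    ≈⟨ +-cong (*ᵛ-· (C + 1#) x w) (-‿cong (·-*ᵛ s x w)) ⟨
      ((C + 1#) *ᵛ x) · w - x · (s *ᵛ w)  ≈⟨ +-cong (·-congʳ w (M-vec j)) (-‿cong (·-congˡ x Mw≋sw)) ⟨
      (M *ᴹ x) · w - x · (M *ᴹ w)         ≈⟨ +-congʳ (·-self-adjoint M M-sym x w) ⟨
      x · (M *ᴹ w) - x · (M *ᴹ w)         ≈⟨ -‿inverseʳ _ ⟩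
      0#                                  ∎)
      where
      open ≤-Reasoning
      x = vec E j

      s≤C : s ≤ C
      s≤C = *-cancelʳ-≤ (·-nonNegative u) (λ uu≈0 → u≉0 (·-definite uu≈0)) (begin
        s * (u · u)     ≤⟨ s-lower u ⟩
        quadratic M u   ≈⟨ ·-congˡ u (M-orthogonal u u⊥E) ⟩
        quadratic A u   ≤⟨ quadratic-bounded A u ⟩
        C * (u · u)     ∎)

      gap≉0 : ¬ C + 1# - s ≈ 0#
      gap≉0 gap≈0 = 1≰0 (begin
        1#                       ≈⟨ +-identityˡ 1# ⟨
        0# + 1#                  ≤⟨ +-mono-≤ (≤⇒0≤- s≤C) ≤-refl ⟩
        C - s + 1#               ≈⟨ solve 3 (λ c s o → c :- s :+ o := c :+ o :- s) refl C s 1# ⟩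
        C + 1# - s               ≈⟨ gap≈0 ⟩
        0#                       ∎)

    -- On the complement of `E`, which contains w, `M` and `A` coincide. So w is an eigenvector of
    -- `A`, and s is a lower bound of the form of `A` there. `IsBottom E` applied to w itself shows
    -- that s is at least every earlier eigenvalue.
    extend : IsBottom E → p ℕ.< n → ∀ {s w} → ¬ w ≋ 0ᵛ → M *ᴹ w ≋ s *ᵛ w → IsFormLowerBound M s →
             ∃ λ (E⁺ : OrthogonalEigenvectors A (suc p)) → IsBottom E⁺
    extend E-bottom p<n {s} {w} w≉0 Mw≋sw s-lower = E⁺ , E⁺-bottom
      where
      open ≤-Reasoning
      w⊥E : IsOrthogonalTo E w
      w⊥E = bottom-orthogonal p<n Mw≋sw s-lower

      ww≉0 : ¬ w · w ≈ 0#
      ww≉0 ww≈0 = w≉0 (·-definite ww≈0)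

      Aw≋sw : A *ᴹ w ≋ s *ᵛ w
      Aw≋sw a = trans (sym (M-orthogonal w w⊥E a)) (Mw≋sw a)

      eigenvalue≤s : ∀ i → eigenvalue E i ≤ s
      eigenvalue≤s i = *-cancelʳ-≤ (·-nonNegative w) ww≉0 (begin
        eigenvalue E i * (w · w)   ≤⟨ E-bottom w w⊥E i ⟩
        quadratic A w              ≈⟨ ·-congˡ w Aw≋sw ⟩
        w · (s *ᵛ w)               ≈⟨ ·-*ᵛ s w w ⟩
        s * (w · w)                ∎)

      E⁺ : OrthogonalEigenvectors A (suc p)
      E⁺ = record
        { eigenvalue = s Vec.∷ eigenvalue E
        ; vec        = w Vec.∷ vec E
        ; weight     = proj₁ (inverse (w · w) ww≉0) Vec.∷ weight E
        ; normalised = λ { zero → proj₂ (inverse (w · w) ww≉0) ; (suc i) → normalised E i }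
        ; orthogonal = λ
          { {zero}  {zero}  0≢0 → contradiction ≡.refl 0≢0
          ; {zero}  {suc j} _   → trans (·-comm w (vec E j)) (w⊥E j)
          ; {suc i} {zero}  _   → w⊥E i
          ; {suc i} {suc j} i≢j → orthogonal E (i≢j ∘ ≡.cong suc)
          }
        ; eigen      = λ { zero → Aw≋sw ; (suc i) → eigen E i }
        ; sorted     = λ
          { zero    zero    _           → ≤-refl
          ; zero    (suc j) _           → eigenvalue≤s j
          ; (suc i) (suc j) (ℕ.s≤s i≤j) → sorted E i j i≤j
          }
        }

      E⁺-bottom : IsBottom E⁺
      E⁺-bottom v v⊥E⁺ (suc i) = E-bottom v (v⊥E⁺ ∘ suc) i
      E⁺-bottom v v⊥E⁺ zero    = begin
        s * (v · v)     ≤⟨ s-lower v ⟩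
        quadratic M v   ≈⟨ ·-congˡ v (M-orthogonal v (v⊥E⁺ ∘ suc)) ⟩
        quadratic A v   ∎

  bottom-eigenvectors : (A : Matrix n) → Symmetric A → ∀ p → p ℕ.≤ n →
                        ∃ λ (E : OrthogonalEigenvectors A p) → IsBottom E
  bottom-eigenvectors A A-sym zero _ = record
    { eigenvalue = λ () ; vec = λ () ; weight = λ () ; normalised = λ () ; orthogonal = λ { {()} }
    ; eigen = λ () ; sorted = λ () } , λ _ _ ()
  bottom-eigenvectors {suc n} A A-sym (suc p) p<n =
    let E , E-bottom = bottom-eigenvectors A A-sym p (ℕₚ.<⇒≤ p<n)
        open Deflation A A-sym E
        s , w , w≉0 , Mw≋sw , s-lower = bottom-eigenpair M M-sym
    in extend E-bottom p<n w≉0 Mw≋sw s-lower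

  orthogonal-eigenbasis : (A : Matrix n) → Symmetric A → OrthogonalEigenvectors A n
  orthogonal-eigenbasis {n} A A-sym = proj₁ (bottom-eigenvectors A A-sym n ℕₚ.≤-refl)

-- Parseval, Bessel, comparison of spectra and Ky Fan's principle.

module KyFan (ℝ : CompleteOrderedField) where
  open CompleteOrderedField ℝ hiding (zero)
  open OrderedField ℝ
  open LinearAlgebra ℝ
  open RayleighQuotient ℝ
  open SpectralTheorem ℝ
  open Spectral ℝ using (sum; Matrix; IsSpectrum; LinearlyIndependent; partialSum)

  private variable
    k n p : ℕ

  module _ {A : Matrix n} (E : OrthogonalEigenvectors A p) where
    open OrthogonalEigenvectors E

    vec-·-combination : (c : Vector Carrier p) → ∀ i → vec i · combination c vec ≈ c i * (vec i · vec i)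
    vec-·-combination c i = trans (·-combination (vec i) c vec)
      (sum-single _ i λ j j≢i → trans (*-congˡ (orthogonal (j≢i ∘ ≡.sym))) (zeroʳ (c j)))

    vec-independent : LinearlyIndependent vec
    vec-independent c combination≋0 i = *-zero-cancelˡ (norm≉0 i) (begin
      (vec i · vec i) * c i      ≈⟨ *-comm _ _ ⟩
      c i * (vec i · vec i)      ≈⟨ vec-·-combination c i ⟨
      vec i · combination c vec  ≈⟨ ·-congˡ (vec i) combination≋0 ⟩
      vec i · 0ᵛ                 ≈⟨ ·-zeroʳ (vec i) ⟩
      0#                         ∎)
      where open ≈-Reasoning

  module Eigenbasis {n} {A : Matrix n} (E : OrthogonalEigenvectors A n) where
    open OrthogonalEigenvectors E

    -- x and the n vectors of E are linearly dependent; as the vectors of E are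
    -- independent, the coefficient of x does not vanish.
    complete : ∀ x → IsOrthogonalTo x → x ≋ 0ᵛ
    complete x x⊥E with homogeneous-solution (ℕₚ.n<1+n n) (λ a → x a Vec.∷ λ j → vec j a)
    ... | z , z≉0 , dependent = ·-definite (*-zero-cancelˡ z₀≉0 (begin
      z zero * (x · x)                                              ≈⟨ +-identityʳ _ ⟨
      z zero * (x · x) + 0#                                         ≈⟨ +-congˡ x·rest ⟨
      z zero * (x · x) + x · combination (Vec.tail z) vec           ≈⟨ +-congʳ (·-*ᵛ (z zero) x x) ⟨
      x · (z zero *ᵛ x) + x · combination (Vec.tail z) vec
        ≈⟨ ·-+ᵛ x (z zero *ᵛ x) (combination (Vec.tail z) vec) ⟨
      x · (z zero *ᵛ x +ᵛ combination (Vec.tail z) vec)             ≈⟨ ·-congˡ x dependence ⟩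
      x · 0ᵛ                                                        ≈⟨ ·-zeroʳ x ⟩
      0#                                                            ∎))
      where
      open ≈-Reasoning
      dependence : z zero *ᵛ x +ᵛ combination (Vec.tail z) vec ≋ 0ᵛ
      dependence a = trans (+-cong (*-comm (z zero) (x a)) (sum-cong-≋ λ j → *-comm (z (suc j)) (vec j a))) (dependent a)

      x·rest : x · combination (Vec.tail z) vec ≈ 0#
      x·rest = trans (·-combination x (Vec.tail z) vec)
        (sum-zero λ j → trans (*-congˡ (trans (·-comm x (vec j)) (x⊥E j))) (zeroʳ _))

      z₀≉0 : ¬ z zero ≈ 0#
      z₀≉0 z₀≈0 = z≉0 λ { zero → z₀≈0 ; (suc j) → vec-independent E (Vec.tail z) tail-dependence j }
        where
        tail-dependence : combination (Vec.tail z) vec ≋ 0ᵛ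
        tail-dependence a = begin
          combination (Vec.tail z) vec a                    ≈⟨ +-identityˡ _ ⟨
          0# + combination (Vec.tail z) vec a               ≈⟨ +-congʳ (trans (*-congʳ z₀≈0) (zeroˡ (x a))) ⟨
          z zero * x a + combination (Vec.tail z) vec a     ≈⟨ dependence a ⟩
          0#                                                ∎

    -- The difference of x and its expansion in the basis is orthogonal to every basis vector, hence
    -- zero by `complete`; take its product with y.
    parseval : ∀ x y → y · x ≈ sum λ j → weight j * (x · vec j) * (y · vec j)
    parseval x y = x-y≈0⇒x≈y (begin
      y · x - sum (λ j → c j * (y · vec j))        ≈⟨ +-congˡ (-‿cong (·-combination y c vec)) ⟨
      y · x - y · combination c vec                ≈⟨ ·-residual y ⟨
      y · residual                                 ≈⟨ ·-congˡ y (complete residual residual⊥E) ⟩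
      y · 0ᵛ                                       ≈⟨ ·-zeroʳ y ⟩
      0#                                           ∎)
      where
      open ≈-Reasoning
      c : Vector Carrier n
      c j = weight j * (x · vec j)

      residual : Vector Carrier n
      residual = x +ᵛ (- 1#) *ᵛ combination c vec

      ·-residual : ∀ y → y · residual ≈ y · x - y · combination c vec
      ·-residual y = begin
        y · residual                                 ≈⟨ ·-+ᵛ y x ((- 1#) *ᵛ combination c vec) ⟩
        y · x + y · ((- 1#) *ᵛ combination c vec)    ≈⟨ +-congˡ (·-*ᵛ (- 1#) y (combination c vec)) ⟩
        y · x + (- 1#) * (y · combination c vec)
          ≈⟨ solve 2 (λ a b → a :+ (:- con (+ 1)) :* b := a :- b) refl (y · x) (y · combination c vec) ⟩
        y · x - y · combination c vec                ∎

      residual⊥E : IsOrthogonalTo residual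
      residual⊥E i = begin
        vec i · residual                                             ≈⟨ ·-residual (vec i) ⟩
        vec i · x - vec i · combination c vec
          ≈⟨ +-cong (·-comm (vec i) x) (-‿cong (vec-·-combination E c i)) ⟩
        x · vec i - weight i * (x · vec i) * (vec i · vec i)
          ≈⟨ solve 3 (λ y d r → y :- d :* y :* r := y :- r :* d :* y) refl (x · vec i) (weight i) (vec i · vec i) ⟩
        x · vec i - (vec i · vec i) * weight i * (x · vec i)
          ≈⟨ +-congˡ (-‿cong (trans (*-congʳ (normalised i)) (*-identityˡ _))) ⟩
        x · vec i - x · vec i                                        ≈⟨ -‿inverseʳ _ ⟩
        0#                                                           ∎

    A-adjoint-vec : Symmetric A → ∀ x j → (A *ᴹ x) · vec j ≈ eigenvalue j * (x · vec j)
    A-adjoint-vec A-sym x j = begin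
      (A *ᴹ x) · vec j               ≈⟨ ·-self-adjoint A A-sym x (vec j) ⟨
      x · (A *ᴹ vec j)               ≈⟨ ·-congˡ x (eigen j) ⟩
      x · (eigenvalue j *ᵛ vec j)    ≈⟨ ·-*ᵛ (eigenvalue j) x (vec j) ⟩
      eigenvalue j * (x · vec j)     ∎
      where open ≈-Reasoning

    quadratic-expansion : Symmetric A → ∀ x →
                          quadratic A x ≈ sum λ j → eigenvalue j * (weight j * ((x · vec j) * (x · vec j)))
    quadratic-expansion A-sym x = begin
      x · (A *ᴹ x)                                                          ≈⟨ ·-comm x (A *ᴹ x) ⟩
      (A *ᴹ x) · x                                                          ≈⟨ parseval x (A *ᴹ x) ⟩
      sum (λ j → weight j * (x · vec j) * ((A *ᴹ x) · vec j))
        ≈⟨ sum-cong-≋ (λ j → trans (*-congˡ (A-adjoint-vec A-sym x j))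
                                                                                 (solve 3 (λ d y μ → d :* y :* (μ :* y)
                                                                                       := μ :* (d :* (y :* y)))
                                                                                       refl (weight j) (x · vec j) (eigenvalue j))) ⟩
      sum (λ j → eigenvalue j * (weight j * ((x · vec j) * (x · vec j))))   ∎
      where open ≈-Reasoning

    -- This makes the hypothesis on simple graphs, which speaks of lists satisfying `IsSpectrum`,
    -- applicable to the eigenvalues constructed here.
    isSpectrum : IsSpectrum A eigenvalue
    isSpectrum = sorted , vec , vec-independent E , λ i →
      (λ vecᵢ≋0 → norm≉0 i (trans (·-congˡ (vec i) vecᵢ≋0) (·-zeroʳ (vec i)))) , eigen i

    -- Parseval with y = x has only non-negative terms, so a prefix of them sums to at most |x|².
    bessel : (k≤n : k ℕ.≤ n) → ∀ x →
             sum {k} (λ i → weight (inject≤ i k≤n) * ((x · vec (inject≤ i k≤n)) * (x · vec (inject≤ i k≤n)))) ≤ x · x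
    bessel k≤n x = begin
      sum (λ i → f (inject≤ i k≤n))
        ≤⟨ prefix-sum≤sum {f = f} k≤n (λ i → *-nonNegative (weight-nonNegative i) (square-nonNegative (x · vec i))) ⟩
      sum f
        ≈⟨ sum-cong-≋ (λ i → *-assoc (weight i) (x · vec i) (x · vec i)) ⟨
      sum (λ i → weight i * (x · vec i) * (x · vec i))       ≈⟨ parseval x x ⟨
      x · x                                                  ∎
      where
      open ≤-Reasoning
      f : Vector Carrier n
      f i = weight i * ((x · vec i) * (x · vec i))

  open OrthogonalEigenvectors

  -- If μ i < λs i, then the first i + 1 vectors of the spectrum are orthogonal to
  -- all but i vectors of E, so some combination of them is orthogonal to E.
  spectrum≤eigenvalue : {A : Matrix n} → Symmetric A → (E : OrthogonalEigenvectors A n) →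
                        ∀ {λs} → IsSpectrum A λs → ∀ i → λs i ≤ eigenvalue E i
  spectrum≤eigenvalue {suc n} {A} A-sym E {λs} (λs-sorted , v , v-independent , v-eigen) i
    with λs i ≤? eigenvalue E i
  ... | yes λᵢ≤μᵢ = λᵢ≤μᵢ
  ... | no  λᵢ≰μᵢ = contradiction (proj₂ (proj₂ solution)) (absurd (proj₁ solution) (proj₁ (proj₂ solution)))
    where
    open ≈-Reasoning
    -- For unknown coefficients c of v: the combination is orthogonal to vec E j if
    -- j < i, and c j = 0 if i < j; the row i is left out.
    equation : Fin (suc n) → Vector Carrier (suc n)
    equation j with j Fin.<? i
    ... | yes _ = λ a → vec E j · v a
    ... | no  _ = unit j

    -- Orthogonality to `vec E i` will follow from `v⊥vec`, so n equations remain for n + 1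
    -- coefficients.
    solution = homogeneous-solution (ℕₚ.n<1+n n) (equation ∘ punchIn i)

    -- Here λs a ≥ λs i > μ i ≥ μ j, where μ are the eigenvalues of `E`, and eigenvectors of a
    -- symmetric matrix for distinct eigenvalues are orthogonal.
    v⊥vec : ∀ a j → a Fin.≤ i → i Fin.≤ j → vec E j · v a ≈ 0#
    v⊥vec a j a≤i i≤j = *-zero-cancelˡ gap≉0 (begin
      (λs a - eigenvalue E j) * (vec E j · v a)
        ≈⟨ solve 3 (λ l m y → (l :- m) :* y := l :* y :- m :* y) refl (λs a) (eigenvalue E j) (vec E j · v a) ⟩
      λs a * (vec E j · v a) - eigenvalue E j * (vec E j · v a)
        ≈⟨ +-cong (·-*ᵛ (λs a) (vec E j) (v a)) (-‿cong (*ᵛ-· (eigenvalue E j) (vec E j) (v a))) ⟨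
      vec E j · (λs a *ᵛ v a) - (eigenvalue E j *ᵛ vec E j) · v a
        ≈⟨ +-cong (·-congˡ (vec E j) (proj₂ (v-eigen a))) (-‿cong (·-congʳ (v a) (eigen E j))) ⟨
      vec E j · (A *ᴹ v a) - (A *ᴹ vec E j) · v a                  ≈⟨ +-congʳ (·-self-adjoint A A-sym (vec E j) (v a)) ⟩
      (A *ᴹ vec E j) · v a - (A *ᴹ vec E j) · v a                  ≈⟨ -‿inverseʳ _ ⟩
      0#                                                           ∎)
      where
      gap≉0 : ¬ λs a - eigenvalue E j ≈ 0#
      gap≉0 gap≈0 = λᵢ≰μᵢ (≤-trans (λs-sorted a i a≤i)
        (≤-trans (≤-reflexive (x-y≈0⇒x≈y gap≈0)) (sorted E i j i≤j)))

    absurd : ∀ c → ¬ c ≋ 0ᵛ → ¬ (equation ∘ punchIn i) *ᴹ c ≋ 0ᵛ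
    absurd c c≉0 solves = c≉0 (v-independent c (Eigenbasis.complete E (combination c v) λ j →
      trans (·-combination (vec E j) c v) (⊥vec j)))
      where
      solves-off : ∀ {j} → i ≢ j → equation j · c ≈ 0#
      solves-off i≢j = ≡.subst (λ j → equation j · c ≈ 0#) (Finₚ.punchIn-punchOut i≢j) (solves (punchOut i≢j))

      c-beyond : ∀ {a} → i Fin.< a → c a ≈ 0#
      c-beyond {a} i<a with a Fin.<? i | solves-off {a} (Finₚ.<⇒≢ i<a)
      ... | yes a<i | _     = contradiction (ℕₚ.<-trans i<a a<i) (ℕₚ.<-irrefl ≡.refl)
      ... | no  _   | uₐ·c≈0 = trans (sym (unit-· a c)) uₐ·c≈0

      ⊥vec : ∀ j → sum (λ a → c a * (vec E j · v a)) ≈ 0#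
      ⊥vec j with j Fin.<? i | solves-off {j}
      ... | yes j<i | solves-j = trans (·-comm c (λ a → vec E j · v a)) (solves-j (Finₚ.<⇒≢ j<i ∘ ≡.sym))
      ... | no  j≮i | _        = sum-zero λ a → term a
        where
        term : ∀ a → c a * (vec E j · v a) ≈ 0#
        term a with a Fin.≤? i
        ... | yes a≤i = trans (*-congˡ (v⊥vec a j a≤i (ℕₚ.≮⇒≥ j≮i))) (zeroʳ (c a))
        ... | no  a≰i = trans (*-congʳ (c-beyond (ℕₚ.≰⇒> a≰i))) (zeroˡ _)

  -- Termwise: f c ≤ f where f is non-negative, and f c ≤ 0 beyond the prefix.
  weighted-sum≤prefix-sum : (k≤n : k ℕ.≤ n) (f c : Vector Carrier n) → (∀ i → 0# ≤ c i) → (∀ i → c i ≤ 1#) →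
                            (∀ i → Fin.toℕ i ℕ.< k → 0# ≤ f i) → (∀ i → k ℕ.≤ Fin.toℕ i → f i ≤ 0#) →
                            sum (λ i → f i * c i) ≤ sum {k} (λ i → f (inject≤ i k≤n))
  weighted-sum≤prefix-sum {zero} {n} k≤n f c 0≤c c≤1 0≤f f≤0 = begin
    sum (λ i → f i * c i)     ≤⟨ sum-mono-≤ (λ i → *-monoʳ-≤ (0≤c i) (f≤0 i ℕ.z≤n)) ⟩
    sum (λ i → 0# * c i)      ≈⟨ sum-zero (λ i → zeroˡ (c i)) ⟩
    0#                        ∎
    where open ≤-Reasoning
  weighted-sum≤prefix-sum {suc k} {suc n} (ℕ.s≤s k≤n) f c 0≤c c≤1 0≤f f≤0 = +-mono-≤
    (≤-trans (*-monoˡ-≤ (0≤f zero (ℕ.s≤s ℕ.z≤n)) (c≤1 zero)) (≤-reflexive (*-identityʳ _)))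
    (weighted-sum≤prefix-sum k≤n (f ∘ suc) (c ∘ suc) (0≤c ∘ suc) (c≤1 ∘ suc)
      (λ i i<k → 0≤f (suc i) (ℕ.s≤s i<k)) (λ i k≤i → f≤0 (suc i) (ℕ.s≤s k≤i)))

  -- Subtract from μ its last value τ inside the prefix, which exists as k ≥ 1. The shifted sequence
  -- is non-negative on the prefix and non-positive after it, and because the weights add up to k
  -- both sides drop by the same amount τ k.
  weighted-sum≤partialSum : (k≤n : k ℕ.≤ n) → 1 ℕ.≤ k → (μ c : Vector Carrier n) →
                            (∀ i j → i Fin.≤ j → μ j ≤ μ i) →
                            (∀ i → 0# ≤ c i) → (∀ i → c i ≤ 1#) → sum c ≈ sum {k} (λ _ → 1#) →
                            sum (λ i → μ i * c i) ≤ partialSum μ k k≤n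
  weighted-sum≤partialSum {suc k} {n} k<n _ μ c μ-sorted 0≤c c≤1 Σc≈k = 0≤-⇒≤ (begin
    0#                                                ≤⟨ ≤⇒0≤- (weighted-sum≤prefix-sum k<n f c 0≤c c≤1 0≤f f≤0) ⟩
    sum (λ i → f (inject≤ i k<n)) - sum (λ i → f i * c i)   ≈⟨ +-cong prefix (-‿cong weighted) ⟩
    partialSum μ (suc k) k<n - τ * K - (sum (λ i → μ i * c i) - τ * K)
      ≈⟨ solve 3 (λ a b c → a :- c :- (b :- c)
            := a :- b) refl (partialSum μ (suc k) k<n) (sum (λ i → μ i * c i)) (τ * K) ⟩
    partialSum μ (suc k) k<n - sum (λ i → μ i * c i)  ∎)
    where
    open ≤-Reasoning
    last = Fin.fromℕ< k<n
    τ = μ last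
    K = sum {suc k} λ _ → 1#

    -- The factor `1#` gives the summand the shape of `sum-shift` with the constant function h = 1,
    -- so that `prefix` is a direct instance.
    f : Vector Carrier n
    f i = μ i + (- τ) * 1#

    f≈ : ∀ i → f i ≈ μ i - τ
    f≈ i = +-congˡ (*-identityʳ (- τ))

    0≤f : ∀ i → Fin.toℕ i ℕ.< suc k → 0# ≤ f i
    0≤f i i<1+k = ≤-trans (≤⇒0≤- (μ-sorted i last (≡.subst (Fin.toℕ i ℕ.≤_) (≡.sym (Finₚ.toℕ-fromℕ< k<n)) (ℕ.s≤s⁻¹ i<1+k))))
                          (≤-reflexive (sym (f≈ i)))

    f≤0 : ∀ i → suc k ℕ.≤ Fin.toℕ i → f i ≤ 0#
    f≤0 i k<i = 0≤-⇒≤ (begin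
      0#
        ≤⟨ ≤⇒0≤- (μ-sorted last i (≡.subst (ℕ._≤ Fin.toℕ i) (≡.sym (Finₚ.toℕ-fromℕ< k<n)) (ℕₚ.<⇒≤ k<i))) ⟩
      τ - μ i          ≈⟨ solve 2 (λ t m → t :- m := con (+ 0) :- (m :- t)) refl τ (μ i) ⟩
      0# - (μ i - τ)   ≈⟨ +-congˡ (-‿cong (f≈ i)) ⟨
      0# - f i         ∎)

    sum-shift : ∀ {p} (g h : Vector Carrier p) → sum (λ i → g i + (- τ) * h i) ≈ sum g - τ * sum h
    sum-shift {p} g h = begin-equality
      sum (λ i → g i + (- τ) * h i)      ≈⟨ ∑-distrib-+ {p} g (λ i → (- τ) * h i) ⟩
      sum g + sum (λ i → (- τ) * h i)    ≈⟨ +-congˡ (*-distribˡ-sum {p} (- τ) h) ⟨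
      sum g + (- τ) * sum h              ≈⟨ solve 3 (λ a t b → a :+ (:- t) :* b := a :- t :* b) refl (sum g) τ (sum h) ⟩
      sum g - τ * sum h                  ∎

    prefix : sum (λ i → f (inject≤ i k<n)) ≈ partialSum μ (suc k) k<n - τ * K
    prefix = sum-shift {suc k} (λ i → μ (inject≤ i k<n)) (λ _ → 1#)

    weighted : sum (λ i → f i * c i) ≈ sum (λ i → μ i * c i) - τ * K
    weighted = begin-equality
      sum (λ i → f i * c i)
        ≈⟨ sum-cong-≋ (λ i → solve 3 (λ m t c → (m :+ (:- t) :* con (+ 1)) :* c
              := m :* c :+ (:- t) :* c) refl (μ i) τ (c i)) ⟩
      sum (λ i → μ i * c i + (- τ) * c i)    ≈⟨ sum-shift {n} (λ i → μ i * c i) c ⟩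
      sum (λ i → μ i * c i) - τ * sum c      ≈⟨ +-congˡ (-‿cong (*-congˡ Σc≈k)) ⟩
      sum (λ i → μ i * c i) - τ * K          ∎

  -- The trace of the compression of M to the span of the first k vectors of E.
  compressionTrace : {A : Matrix n} → OrthogonalEigenvectors A n → (k : ℕ) → k ℕ.≤ n → Matrix n → Carrier
  compressionTrace E k k≤n M = sum {k} λ i → weight E (inject≤ i k≤n) * quadratic M (vec E (inject≤ i k≤n))

  -- When `A` itself is compressed to the span of its own eigenvectors, the terms of the trace are
  -- the eigenvalues of `E`, which dominate any spectrum entrywise.
  partialSum≤compressionTrace : {A : Matrix n} → Symmetric A → (E : OrthogonalEigenvectors A n) →
                                ∀ {λs} → IsSpectrum A λs → (k≤n : k ℕ.≤ n) →
                                partialSum λs k k≤n ≤ compressionTrace E k k≤n A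
  partialSum≤compressionTrace {n} {k} {A} A-sym E {λs} λs-spectrum k≤n = sum-mono-≤ {k} λ i → term (inject≤ i k≤n)
    where
    open ≤-Reasoning
    term : ∀ i → λs i ≤ weight E i * quadratic A (vec E i)
    term i = begin
      λs i                                              ≤⟨ spectrum≤eigenvalue A-sym E λs-spectrum i ⟩
      eigenvalue E i                                    ≈⟨ *-cancel-inverse (normalised E i) ⟨
      weight E i * ((vec E i · vec E i) * eigenvalue E i)   ≈⟨ *-congˡ (*-comm _ _) ⟩
      weight E i * (eigenvalue E i * (vec E i · vec E i))   ≈⟨ *-congˡ (·-*ᵛ (eigenvalue E i) (vec E i) (vec E i)) ⟨
      weight E i * (vec E i · (eigenvalue E i *ᵛ vec E i))  ≈⟨ *-congˡ (·-congˡ (vec E i) (eigen E i)) ⟨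
      weight E i * quadratic A (vec E i)                ∎

  -- Ky Fan's principle. Expanding in the basis `F` writes the trace as the sum of μ_j c_j, where
  -- c_j is the squared length of the projection of the j-th vector of `F`, normalised, to the span
  -- of the first k vectors of `E`. Bessel for `E` gives c_j ≤ 1, and Parseval for `F` shows that
  -- the c_j add up to k.
  compressionTrace≤partialSum : {A M : Matrix n} → Symmetric M →
                                (E : OrthogonalEigenvectors A n) (F : OrthogonalEigenvectors M n) →
                                1 ℕ.≤ k → (k≤n : k ℕ.≤ n) →
                                compressionTrace E k k≤n M ≤ partialSum (eigenvalue F) k k≤n
  compressionTrace≤partialSum {n} {k} {A} {M} M-sym E F 1≤k k≤n = begin
    sum (λ i → d i * quadratic M (u i))                        ≈⟨ sum-cong-≋ {k} expand ⟩
    sum (λ i → sum λ j → μ j * (d i * (e j * (t i j * t i j))))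
      ≈⟨ ∑-comm {k} {n} (λ i j → μ j * (d i * (e j * (t i j * t i j)))) ⟩
    sum (λ j → sum λ i → μ j * (d i * (e j * (t i j * t i j))))
      ≈⟨ sum-cong-≋ {n} (λ j → *-distribˡ-sum {k} (μ j) (λ i → d i * (e j * (t i j * t i j)))) ⟨
    sum (λ j → μ j * c j)
      ≤⟨ weighted-sum≤partialSum k≤n 1≤k μ c (sorted F) 0≤c c≤1 Σc≈k ⟩
    partialSum μ k k≤n                                         ∎
    where
    open ≤-Reasoning
    μ = eigenvalue F
    e = weight F
    w = vec F

    d : Vector Carrier k
    d i = weight E (inject≤ i k≤n)

    u : Vector (Vector Carrier n) k
    u i = vec E (inject≤ i k≤n)

    t : Fin k → Fin n → Carrier
    t i j = u i · w j

    c : Vector Carrier n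
    c j = sum λ i → d i * (e j * (t i j * t i j))

    expand : ∀ i → d i * quadratic M (u i) ≈ sum λ j → μ j * (d i * (e j * (t i j * t i j)))
    expand i = begin-equality
      d i * quadratic M (u i)                               ≈⟨ *-congˡ (Eigenbasis.quadratic-expansion F M-sym (u i)) ⟩
      d i * sum (λ j → μ j * (e j * (t i j * t i j)))
        ≈⟨ *-distribˡ-sum {n} (d i) (λ j → μ j * (e j * (t i j * t i j))) ⟩
      sum (λ j → d i * (μ j * (e j * (t i j * t i j))))
        ≈⟨ sum-cong-≋ {n} (λ j → solve 3 (λ d m r → d :* (m :* r)
              := m :* (d :* r)) refl (d i) (μ j) (e j * (t i j * t i j))) ⟩
      sum (λ j → μ j * (d i * (e j * (t i j * t i j))))     ∎

    0≤c : ∀ j → 0# ≤ c j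
    0≤c j = sum-nonNegative {k} λ i → *-nonNegative (weight-nonNegative E (inject≤ i k≤n))
      (*-nonNegative (weight-nonNegative F j) (square-nonNegative (t i j)))

    c≤1 : ∀ j → c j ≤ 1#
    c≤1 j = begin
      c j
        ≈⟨ sum-cong-≋ {k} (λ i → trans (solve 3 (λ d e r → d :* (e :* r)
              := e :* (d :* r)) refl (d i) (e j) (t i j * t i j))
                                                                     (*-congˡ (*-congˡ (*-cong (·-comm (u i) (w j)) (·-comm (u i) (w j)))))) ⟩
      sum (λ i → e j * (d i * ((w j · u i) * (w j · u i))))
        ≈⟨ *-distribˡ-sum {k} (e j) (λ i → d i * ((w j · u i) * (w j · u i))) ⟨
      e j * sum (λ i → d i * ((w j · u i) * (w j · u i)))
        ≤⟨ *-monoˡ-≤ (weight-nonNegative F j) (Eigenbasis.bessel E k≤n (w j)) ⟩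
      e j * (w j · w j)                                         ≈⟨ *-comm _ _ ⟩
      (w j · w j) * e j                                         ≈⟨ normalised F j ⟩
      1#                                                        ∎

    Σc≈k : sum c ≈ sum {k} λ _ → 1#
    Σc≈k = begin-equality
      sum (λ j → sum λ i → d i * (e j * (t i j * t i j)))
        ≈⟨ ∑-comm {n} {k} (λ j i → d i * (e j * (t i j * t i j))) ⟩
      sum (λ i → sum λ j → d i * (e j * (t i j * t i j)))       ≈⟨ sum-cong-≋ {k} (λ i → begin-equality
        sum (λ j → d i * (e j * (t i j * t i j)))
          ≈⟨ *-distribˡ-sum {n} (d i) (λ j → e j * (t i j * t i j)) ⟨
        d i * sum (λ j → e j * (t i j * t i j))
          ≈⟨ *-congˡ (sum-cong-≋ {n} λ j → *-assoc (e j) (t i j) (t i j)) ⟨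
        d i * sum (λ j → e j * t i j * t i j)                     ≈⟨ *-congˡ (Eigenbasis.parseval F (u i) (u i)) ⟨
        d i * (u i · u i)                                         ≈⟨ *-comm _ _ ⟩
        (u i · u i) * d i                                         ≈⟨ normalised E (inject≤ i k≤n) ⟩
        1#                                                        ∎) ⟩
      sum {k} (λ _ → 1#)                                        ∎

-- Redundancy and the deletion of edges.

∈-sublists⇒⊆ : {A : Set} {xs ys : List A} → xs ∈ sublists ys → xs ⊆ ys
∈-sublists⇒⊆ {ys = []}     (here ≡.refl) = []
∈-sublists⇒⊆ {ys = y ∷ ys} xs∈ with ∈-++⁻ (map (y ∷_) (sublists ys)) xs∈
... | inj₂ xs∈sublists = y ∷ʳ ∈-sublists⇒⊆ xs∈sublists
... | inj₁ xs∈map with ∈-map⁻ (y ∷_) xs∈map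
... | zs , zs∈sublists , ≡.refl = ≡.refl ∷ ∈-sublists⇒⊆ zs∈sublists

self∈sublists : {A : Set} (xs : List A) → xs ∈ sublists xs
self∈sublists []       = here ≡.refl
self∈sublists (x ∷ xs) = ∈-++⁺ˡ (∈-map⁺ (x ∷_) (self∈sublists xs))

[]∈sublists : {A : Set} (xs : List A) → [] ∈ sublists xs
[]∈sublists []       = here ≡.refl
[]∈sublists (x ∷ xs) = ∈-++⁺ʳ (map (x ∷_) (sublists xs)) ([]∈sublists xs)

redundancy-attained : (G : Quiver) → let open Quiver G in
                      ∃ λ kept → kept ⊆ edges × NoMultipleConnections kept × redundancy G ≡ m ∸ length kept
redundancy-attained G with Extrema.argmin-sel id m (map (λ kept → m ∸ length kept) (filter noMultipleConnections? (sublists edges)))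
  where open Quiver G
-- The default value `m` of `min` is attained as well: it is the cost of keeping no edge.
... | inj₁ r≡m = [] , ∈-sublists⇒⊆ ([]∈sublists edges) , (λ _ _ _ → ℕ.z≤n) , r≡m
  where open Quiver G
... | inj₂ r∈map with ∈-map⁻ _ r∈map
... | kept , kept∈filter , r≡ with ∈-filter⁻ noMultipleConnections? kept∈filter
... | kept∈sublists , simple = kept , ∈-sublists⇒⊆ kept∈sublists , simple , r≡

-- The whole edge list is among the candidates, at cost m ∸ m.
simple⇒redundancy≡0 : (G : Quiver) → IsSimple G → redundancy G ≡ 0
simple⇒redundancy≡0 G (_ , noMultiple) = ℕₚ.n≤0⇒n≡0 (≡.subst (redundancy G ℕ.≤_) (ℕₚ.n∸n≡0 m)
  (All.lookup (Extrema.min≤xs m _)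
    (∈-map⁺ (λ kept → m ∸ length kept) (∈-filter⁺ noMultipleConnections? (self∈sublists edges) noMultiple))))
  where open Quiver G

isNonLoop? : ∀ {n} (e : Edge n) → Dec (proj₁ e ≢ proj₂ e)
isNonLoop? (a , b) = ¬? (a Fin.≟ b)

withoutLoops : ∀ {n} → List (Edge n) → List (Edge n)
withoutLoops = filter isNonLoop?

withoutLoops-noMultiple : ∀ {n} (es : List (Edge n)) → NoMultipleConnections es → NoMultipleConnections (withoutLoops es)
withoutLoops-noMultiple es noMultiple i j i≢j =
  ℕₚ.≤-trans (length-mono-≤ (filter⁺ (joins? i j) (joins? i j) (λ { ≡.refl → id }) (filter-⊆ isNonLoop? es))) (noMultiple i j i≢j)

-- Incidence vectors and the reduction to simple graphs.

module Reduction (ℝ : CompleteOrderedField) where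
  open CompleteOrderedField ℝ hiding (zero)
  open OrderedField ℝ
  open LinearAlgebra ℝ
  open RayleighQuotient ℝ
  open SpectralTheorem ℝ
  open KyFan ℝ
  open Spectral ℝ
  open SemiringMult semiring using (×-homo-+)
  open RingProperties ring using (-0#≈0#; -‿+-comm)
  open OrthogonalEigenvectors

  private variable
    n k : ℕ

  -- The order of the pair only fixes a sign, which cancels because the vector always enters
  -- quadratically. A loop falls under the first case and gives a unit vector, in agreement with its
  -- contribution 1 to the degree.
  incidence : Edge n → Vector Carrier n
  incidence (a , b) i with a Fin.≟ i | b Fin.≟ i
  ... | yes _ | _     = 1#
  ... | no  _ | yes _ = - 1#
  ... | no  _ | no  _ = 0#

  incidence-source : (a b : Fin n) → incidence (a , b) a ≈ 1#
  incidence-source a b with a Fin.≟ a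
  ... | yes _   = refl
  ... | no  a≢a = contradiction ≡.refl a≢a

  incidence-target : {a b : Fin n} → a ≢ b → incidence (a , b) b ≈ - 1#
  incidence-target {a = a} {b} a≢b with a Fin.≟ b | b Fin.≟ b
  ... | yes a≡b | _       = contradiction a≡b a≢b
  ... | no  _   | yes _   = refl
  ... | no  _   | no  b≢b = contradiction ≡.refl b≢b

  incidence-off : {a b i : Fin n} → a ≢ i → b ≢ i → incidence (a , b) i ≈ 0#
  incidence-off {a = a} {b} {i} a≢i b≢i with a Fin.≟ i | b Fin.≟ i
  ... | yes a≡i | _       = contradiction a≡i a≢i
  ... | no  _   | yes b≡i = contradiction b≡i b≢i
  ... | no  _   | no  _   = refl

  incidence-loop : (a i : Fin n) → incidence (a , a) i ≈ unit a i
  incidence-loop a i with a Fin.≟ i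
  ... | yes _ = refl
  ... | no  _ = refl

  incidence²≤ : (a b i : Fin n) → incidence (a , b) i * incidence (a , b) i ≤ unit a i + unit b i
  incidence²≤ a b i with a Fin.≟ i | b Fin.≟ i
  ... | yes _ | yes _ = ≤-trans (≤-reflexive (*-identityˡ 1#)) (≤-trans (≤-reflexive (sym (+-identityʳ 1#))) (+-monoʳ-≤ 1# 0≤1))
  ... | yes _ | no  _ = ≤-reflexive (trans (*-identityˡ 1#) (sym (+-identityʳ 1#)))
  ... | no  _ | yes _ = ≤-reflexive (solve 0 ((:- con (+ 1)) :* (:- con (+ 1)) := con (+ 0) :+ con (+ 1)) refl)
  ... | no  _ | no  _ = ≤-reflexive (trans (zeroˡ 0#) (sym (+-identityˡ 0#)))

  incidence-norm≤2 : (e : Edge n) → incidence e · incidence e ≤ 1# + 1#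
  incidence-norm≤2 {n} (a , b) = begin
    incidence (a , b) · incidence (a , b)    ≤⟨ sum-mono-≤ (incidence²≤ a b) ⟩
    sum (λ i → unit a i + unit b i)          ≈⟨ ∑-distrib-+ {n} (unit a) (unit b) ⟩
    sum (unit a) + sum (unit b)              ≈⟨ +-cong (sum-unit a) (sum-unit b) ⟩
    1# + 1#                                  ∎
    where
    open ≤-Reasoning
    sum-unit : (a : Fin n) → sum (unit a) ≈ 1#
    sum-unit a = trans (sum-single (unit a) a λ j j≢a → unit-off (j≢a ∘ ≡.sym)) (unit-diag a)

  incidence-norm-loop : (a : Fin n) → incidence (a , a) · incidence (a , a) ≈ 1#
  incidence-norm-loop a = trans (·-cong (incidence-loop a) (incidence-loop a)) (trans (unit-· a (unit a)) (unit-diag a))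

  incidence-incident : ∀ {i : Fin n} {e} → Incident i e → incidence e i * incidence e i ≈ 1#
  incidence-incident {i = i} {a , b} incident with a Fin.≟ i | b Fin.≟ i
  ... | yes _   | _       = *-identityˡ 1#
  ... | no  _   | yes _   = solve 0 ((:- con (+ 1)) :* (:- con (+ 1)) := con (+ 1)) refl
  ... | no  a≢i | no  b≢i with incident
  ... | inj₁ a≡i = contradiction a≡i a≢i
  ... | inj₂ b≡i = contradiction b≡i b≢i

  incidence-not-incident : ∀ {i : Fin n} {e} → ¬ Incident i e → incidence e i * incidence e i ≈ 0#
  incidence-not-incident {i = i} {e} not-incident =
    trans (*-congʳ (incidence-off (not-incident ∘ inj₁) (not-incident ∘ inj₂))) (zeroˡ (incidence e i))

  incidence-joins : ∀ {i j : Fin n} {e} → i ≢ j → Joins i j e → incidence e i * incidence e j ≈ - 1#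
  incidence-joins {i = i} {j} i≢j (inj₁ ≡.refl) =
    trans (*-cong (incidence-source i j) (incidence-target i≢j)) (*-identityˡ (- 1#))
  incidence-joins {i = i} {j} i≢j (inj₂ ≡.refl) =
    trans (*-cong (incidence-target (i≢j ∘ ≡.sym)) (incidence-source j i)) (*-identityʳ (- 1#))

  incidence-not-joins : ∀ {i j : Fin n} {e} → i ≢ j → ¬ Joins i j e → incidence e i * incidence e j ≈ 0#
  incidence-not-joins {i = i} {j} {a , b} i≢j not-joins = cases (a Fin.≟ i) (b Fin.≟ i)
    where
    cases : Dec (a ≡ i) → Dec (b ≡ i) → incidence (a , b) i * incidence (a , b) j ≈ 0#
    cases (yes ≡.refl) _ = trans (*-congˡ (incidence-off {a = a} {b} {j} i≢j λ { ≡.refl → not-joins (inj₁ ≡.refl) })) (zeroʳ _)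
    cases (no _) (yes ≡.refl) = trans (*-congˡ (incidence-off {a = a} {b} {j} (λ { ≡.refl → not-joins (inj₂ ≡.refl) }) i≢j)) (zeroʳ _)
    cases (no a≢i) (no b≢i) = trans (*-congʳ (incidence-off a≢i b≢i)) (zeroˡ _)

  gram : List (Edge n) → Matrix n
  gram []       i   = 0ᵛ
  gram (e ∷ es) i   = incidence e i *ᵛ incidence e +ᵛ gram es i

  gram-sym : (es : List (Edge n)) → Symmetric (gram es)
  gram-sym []       i j = refl
  gram-sym (e ∷ es) i j = +-cong (*-comm (incidence e i) (incidence e j)) (gram-sym es i j)

  degree-gram : (es : List (Edge n)) → ∀ i → fromℕ (degree es i) ≈ gram es i i
  degree-gram []       i = refl
  degree-gram (e ∷ es) i with incident? i e
  ... | yes incident = trans (reflexive (≡.cong (fromℕ ∘ length) (filter-accept (incident? i) {xs = es} incident)))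
                             (+-cong (sym (incidence-incident incident)) (degree-gram es i))
  ... | no not-incident = trans (reflexive (≡.cong (fromℕ ∘ length) (filter-reject (incident? i) {xs = es} not-incident)))
                         (trans (degree-gram es i)
                         (trans (sym (+-identityˡ _)) (+-congʳ (sym (incidence-not-incident not-incident)))))

  multiplicity-gram : (es : List (Edge n)) → ∀ {i j} → i ≢ j → - fromℕ (multiplicity es i j) ≈ gram es i j
  multiplicity-gram []       i≢j = -0#≈0#
  multiplicity-gram (e ∷ es) {i} {j} i≢j with joins? i j e
  ... | yes joins = trans (reflexive (≡.cong (-_ ∘ fromℕ ∘ length) (filter-accept (joins? i j) {xs = es} joins)))
                   (trans (sym (-‿+-comm _ _))
                          (+-cong (sym (incidence-joins i≢j joins)) (multiplicity-gram es i≢j)))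
  ... | no not-joins = trans (reflexive (≡.cong (-_ ∘ fromℕ ∘ length) (filter-reject (joins? i j) {xs = es} not-joins)))
                      (trans (multiplicity-gram es i≢j)
                      (trans (sym (+-identityˡ _)) (+-congʳ (sym (incidence-not-joins i≢j not-joins)))))

  fromℤ-neg : ∀ a → fromℤ (ℤ.- (+ a)) ≈ - fromℕ a
  fromℤ-neg zero    = sym -0#≈0#
  fromℤ-neg (suc a) = refl

  kirchhoff-gram : (G : Quiver) → ∀ i j → kirchhoffℝ G i j ≈ gram (Quiver.edges G) i j
  kirchhoff-gram G i j with i Fin.≟ j
  ... | yes ≡.refl = degree-gram (Quiver.edges G) i
  ... | no  i≢j    = trans (fromℤ-neg (multiplicity (Quiver.edges G) i j)) (multiplicity-gram (Quiver.edges G) i≢j)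

  kirchhoff-sym : (G : Quiver) → Symmetric (kirchhoffℝ G)
  kirchhoff-sym G i j = trans (kirchhoff-gram G i j)
    (trans (gram-sym (Quiver.edges G) i j) (sym (kirchhoff-gram G j i)))

  quadratic-gram : ∀ e (es : List (Edge n)) v →
                   quadratic (gram (e ∷ es)) v ≈ (incidence e · v) * (incidence e · v) + quadratic (gram es) v
  quadratic-gram e es v = begin
    v · (gram (e ∷ es) *ᴹ v)
      ≈⟨ ·-congˡ v (λ a → trans (+ᵛ-· (incidence e a *ᵛ incidence e) (gram es a) v)
                                                                    (+-congʳ (trans (*ᵛ-· (incidence e a) (incidence e) v) (*-comm _ _)))) ⟩
    v · ((incidence e · v) *ᵛ incidence e +ᵛ gram es *ᴹ v)
      ≈⟨ ·-+ᵛ v ((incidence e · v) *ᵛ incidence e) (gram es *ᴹ v) ⟩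
    v · ((incidence e · v) *ᵛ incidence e) + quadratic (gram es) v
      ≈⟨ +-congʳ (trans (·-*ᵛ (incidence e · v) v (incidence e)) (*-congˡ (·-comm v (incidence e)))) ⟩
    (incidence e · v) * (incidence e · v) + quadratic (gram es) v   ∎
    where open ≈-Reasoning

  module EdgeContributions {A : Matrix n} (E : OrthogonalEigenvectors A n) {k} (k≤n : k ℕ.≤ n) where
    -- The squared length of the projection of `incidence e` to the span of the first k vectors of
    -- `E`, which is the trace of the compression of its rank one summand.
    contribution : Edge n → Carrier
    contribution e = sum {k} λ i → weight E (inject≤ i k≤n) *
      ((incidence e · vec E (inject≤ i k≤n)) * (incidence e · vec E (inject≤ i k≤n)))

    totalContribution : List (Edge n) → Carrier
    totalContribution = foldr (λ e s → contribution e + s) 0#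

    compressionTrace-gram : ∀ es → compressionTrace E k k≤n (gram es) ≈ totalContribution es
    compressionTrace-gram [] = sum-zero {k} λ i →
      trans (*-congˡ (sum-zero {n} λ a → trans (*-congˡ (sum-zero {n} λ b → zeroˡ _)) (zeroʳ _))) (zeroʳ _)
    compressionTrace-gram (e ∷ es) = begin
      compressionTrace E k k≤n (gram (e ∷ es))
        ≈⟨ sum-cong-≋ {k} (λ i → trans (*-congˡ (quadratic-gram e es (u i))) (distribˡ (d i) _ _)) ⟩
      sum (λ i → d i * ((incidence e · u i) * (incidence e · u i)) + d i * quadratic (gram es) (u i))
                                                       ≈⟨ ∑-distrib-+ {k} (λ i → d i * ((incidence e · u i) * (incidence e · u i))) (λ i → d i * quadratic (gram es) (u i)) ⟩
      contribution e + compressionTrace E k k≤n (gram es)  ≈⟨ +-congˡ (compressionTrace-gram es) ⟩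
      contribution e + totalContribution es                        ∎
      where
      open ≈-Reasoning
      d : Vector Carrier k
      d i = weight E (inject≤ i k≤n)
      u : Vector (Vector Carrier n) k
      u i = vec E (inject≤ i k≤n)



    contribution≤2 : ∀ e → contribution e ≤ 1# + 1#
    contribution≤2 e = ≤-trans (Eigenbasis.bessel E k≤n (incidence e)) (incidence-norm≤2 e)

    contribution-loop≤1 : ∀ a → contribution (a , a) ≤ 1#
    contribution-loop≤1 a = ≤-trans (Eigenbasis.bessel E k≤n (incidence (a , a))) (≤-reflexive (incidence-norm-loop a))

    -- Each dropped edge lowers the total by at most 2. Lengths are added on both sides so that the
    -- induction needs no subtraction.
    totalContribution-⊆ : ∀ {kept es} → kept ⊆ es →
                    totalContribution es + (fromℕ (length kept) + fromℕ (length kept)) ≤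
                    totalContribution kept + (fromℕ (length es) + fromℕ (length es))
    totalContribution-⊆ [] = ≤-refl
    totalContribution-⊆ {kept} {e ∷ es} (e ∷ʳ kept⊆es) = begin
      contribution e + totalContribution es + (K + K)    ≈⟨ +-assoc _ _ _ ⟩
      contribution e + (totalContribution es + (K + K))  ≤⟨ +-mono-≤ (contribution≤2 e) (totalContribution-⊆ kept⊆es) ⟩
      1# + 1# + (totalContribution kept + (L + L))
        ≈⟨ solve 3 (λ o t l → o :+ o :+ (t :+ (l :+ l))
              := t :+ (o :+ l :+ (o :+ l))) refl 1# (totalContribution kept) L ⟩
      totalContribution kept + (1# + L + (1# + L))       ∎
      where
      open ≤-Reasoning
      K = fromℕ (length kept)
      L = fromℕ (length es)
    totalContribution-⊆ {e ∷ kept} {.e ∷ es} (≡.refl ∷ kept⊆es) = begin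
      contribution e + totalContribution es + (1# + K + (1# + K))
        ≈⟨ regroup (contribution e) (totalContribution es) K ⟩
      contribution e + (1# + 1#) + (totalContribution es + (K + K))    ≤⟨ +-monoʳ-≤ _ (totalContribution-⊆ kept⊆es) ⟩
      contribution e + (1# + 1#) + (totalContribution kept + (L + L))
        ≈⟨ regroup (contribution e) (totalContribution kept) L ⟨
      contribution e + totalContribution kept + (1# + L + (1# + L))    ∎
      where
      open ≤-Reasoning
      K = fromℕ (length kept)
      L = fromℕ (length es)
      regroup : ∀ c t k → c + t + (1# + k + (1# + k)) ≈ c + (1# + 1#) + (t + (k + k))
      regroup = solve 3 (λ c t k → c :+ t :+ (con (+ 1) :+ k :+ (con (+ 1) :+ k))
            := c :+ (con (+ 1) :+ con (+ 1)) :+ (t :+ (k :+ k))) refl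

    -- The same count with the rate 1, as only loops are dropped.
    totalContribution-withoutLoops : ∀ es → totalContribution es + fromℕ (length (withoutLoops es)) ≤
                                totalContribution (withoutLoops es) + fromℕ (length es)
    totalContribution-withoutLoops [] = ≤-refl
    totalContribution-withoutLoops ((a , b) ∷ es) with a Fin.≟ b
    ... | yes ≡.refl = begin
      contribution (a , a) + totalContribution es + K    ≈⟨ +-assoc _ _ _ ⟩
      contribution (a , a) + (totalContribution es + K)
        ≤⟨ +-mono-≤ (contribution-loop≤1 a) (totalContribution-withoutLoops es) ⟩
      1# + (totalContribution (withoutLoops es) + L)
        ≈⟨ solve 3 (λ o t l → o :+ (t :+ l) := t :+ (o :+ l)) refl 1# (totalContribution (withoutLoops es)) L ⟩
      totalContribution (withoutLoops es) + (1# + L)     ∎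
      where
      open ≤-Reasoning
      K = fromℕ (length (withoutLoops es))
      L = fromℕ (length es)
    ... | no _ = begin
      c + totalContribution es + (1# + K)                   ≈⟨ regroup c (totalContribution es) 1# K ⟩
      c + 1# + (totalContribution es + K)                   ≤⟨ +-monoʳ-≤ _ (totalContribution-withoutLoops es) ⟩
      c + 1# + (totalContribution (withoutLoops es) + L)    ≈⟨ regroup c (totalContribution (withoutLoops es)) 1# L ⟨
      c + totalContribution (withoutLoops es) + (1# + L)    ∎
      where
      open ≤-Reasoning
      c = contribution (a , b)
      K = fromℕ (length (withoutLoops es))
      L = fromℕ (length es)
      regroup : ∀ c t o k → c + t + (o + k) ≈ c + o + (t + k)
      regroup = solve 4 (λ c t o k → c :+ t :+ (o :+ k) := c :+ o :+ (t :+ k)) refl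

  compressionTrace-cong : {A M N : Matrix n} (E : OrthogonalEigenvectors A n) (k≤n : k ℕ.≤ n) →
                          (∀ i j → M i j ≈ N i j) → compressionTrace E k k≤n M ≈ compressionTrace E k k≤n N
  compressionTrace-cong {k = k} E k≤n M≈N = sum-cong-≋ {k} λ i →
    *-congˡ (·-congˡ (vec E (inject≤ i k≤n)) λ a → ·-congʳ (vec E (inject≤ i k≤n)) (M≈N a))

  -- Edges are deleted in two stages. A list that attains the redundancy may still contain loops,
  -- which are dropped afterwards at the cheaper rate. One eigenbasis `E`, that of K(G), serves to
  -- compress both K(G) and the Kirchhoff matrix of the simple graph.
  simple-S≤B⇒S≤B : (∀ G → IsSimple G → ∀ k → 1 ℕ.≤ k → (k≤n : k ℕ.≤ Quiver.n G) → S≤B G k k≤n) →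
                   ∀ G k → 1 ℕ.≤ k → (k≤n : k ℕ.≤ Quiver.n G) → S≤B G k k≤n
  simple-S≤B⇒S≤B simple-S≤B G k 1≤k k≤n λs λs-spectrum = bound (redundancy-attained G)
    where
    open ≤-Reasoning
    open Quiver G using (m; edges)

    E : OrthogonalEigenvectors (kirchhoffℝ G) (Quiver.n G)
    E = orthogonal-eigenbasis (kirchhoffℝ G) (kirchhoff-sym G)

    open EdgeContributions E k≤n

    triangular : ℕ
    triangular = (k ℕ.* (k ℕ.+ 1)) ℕ./ 2

    bound : (∃ λ kept → kept ⊆ edges × NoMultipleConnections kept × redundancy G ≡ m ∸ length kept) →
            partialSum λs k k≤n ≤ fromℕ (B G k)
    bound (kept , kept⊆edges , kept-noMultiple , r≡) = begin
      partialSum λs k k≤n                     ≤⟨ partialSum≤compressionTrace (kirchhoff-sym G) E λs-spectrum k≤n ⟩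
      compressionTrace E k k≤n (kirchhoffℝ G) ≈⟨ compressionTrace-cong E k≤n (kirchhoff-gram G) ⟩
      compressionTrace E k k≤n (gram edges)   ≈⟨ compressionTrace-gram edges ⟩
      T                                       ≈⟨ solve 2 (λ t x → t := t :+ (x :+ x) :- (x :+ x)) refl T K ⟩
      T + (K + K) - (K + K)                   ≤⟨ +-mono-≤ (totalContribution-⊆ kept⊆edges) ≤-refl ⟩
      T′ + (L + L) - (K + K)
        ≈⟨ solve 4 (λ t l x h → t :+ (l :+ l) :- (x :+ x) := t :+ h :+ (l :+ l :- (x :+ x) :- h)) refl T′ L K H# ⟩
      T′ + H# + (L + L - (K + K) - H#)        ≤⟨ +-mono-≤ (totalContribution-withoutLoops kept) ≤-refl ⟩
      T″ + K + (L + L - (K + K) - H#)         ≤⟨ +-mono-≤ (+-mono-≤ simple-bound ≤-refl) ≤-refl ⟩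
      -- The edge terms are `H#` for the simple graph, K - H# for the loops and 2 (L - K) for the
      -- redundant edges. Their sum is L + (L - K), and L - K is the redundancy.
      H# + D + K + (L + L - (K + K) - H#)
        ≈⟨ solve 4 (λ h d x l → h :+ d :+ x :+ (l :+ l :- (x :+ x) :- h) := l :+ (l :- x) :+ d) refl H# D K L ⟩
      L + (L - K) + D                         ≈⟨ +-congʳ (+-congˡ (+-congʳ L≈R+K)) ⟩
      L + (R + K - K) + D
        ≈⟨ solve 4 (λ l r x d → l :+ (r :+ x :- x) :+ d := l :+ r :+ d) refl L R K D ⟩
      L + R + D                               ≈⟨ +-congʳ (×-homo-+ 1# m (redundancy G)) ⟨
      fromℕ (m ℕ.+ redundancy G) + D          ≈⟨ ×-homo-+ 1# (m ℕ.+ redundancy G) triangular ⟨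
      fromℕ (B G k)                           ∎
      where
      H : Quiver
      -- All vertices are retained, so that `E` and `k≤n` apply to `H` without change.
      H = record { n = Quiver.n G ; edges = withoutLoops kept }

      H-simple : IsSimple H
      H-simple = all-filter isNonLoop? kept , withoutLoops-noMultiple kept kept-noMultiple

      F : OrthogonalEigenvectors (kirchhoffℝ H) (Quiver.n G)
      F = orthogonal-eigenbasis (kirchhoffℝ H) (kirchhoff-sym H)

      T T′ T″ L K H# R D : Carrier
      T  = totalContribution edges
      T′ = totalContribution kept
      T″ = totalContribution (withoutLoops kept)
      L  = fromℕ m
      K  = fromℕ (length kept)
      H# = fromℕ (length (withoutLoops kept))
      R  = fromℕ (redundancy G)
      D  = fromℕ triangular

      simple-bound : T″ ≤ H# + D
      simple-bound = begin
        T″                                                ≈⟨ compressionTrace-gram (withoutLoops kept) ⟨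
        compressionTrace E k k≤n (gram (withoutLoops kept)) ≈⟨ compressionTrace-cong E k≤n (kirchhoff-gram H) ⟨
        compressionTrace E k k≤n (kirchhoffℝ H)           ≤⟨ compressionTrace≤partialSum (kirchhoff-sym H) E F 1≤k k≤n ⟩
        partialSum (eigenvalue F) k k≤n
          ≤⟨ simple-S≤B H H-simple k 1≤k k≤n (eigenvalue F) (Eigenbasis.isSpectrum F) ⟩
        fromℕ (Quiver.m H ℕ.+ redundancy H ℕ.+ triangular) ≈⟨ reflexive (≡.cong (λ r → fromℕ (r ℕ.+ triangular))
                                                               (≡.trans (≡.cong (Quiver.m H ℕ.+_) (simple⇒redundancy≡0 H H-simple)) (ℕₚ.+-identityʳ _))) ⟩
        fromℕ (Quiver.m H ℕ.+ triangular)                 ≈⟨ ×-homo-+ 1# (Quiver.m H) triangular ⟩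
        H# + D                                            ∎

      -- The truncated subtraction in the redundancy is exact because the kept edges form a sublist
      -- of `edges`.
      L≈R+K : L ≈ R + K
      L≈R+K = trans (reflexive (≡.cong fromℕ (≡.sym (≡.trans (≡.cong (ℕ._+ length kept) r≡) (ℕₚ.m∸n+n≡m (length-mono-≤ kept⊆edges))))))
                    (×-homo-+ 1# (redundancy G) (length kept))

open import Data.Nat using (_≤_)

theorem2 : (ℝ : CompleteOrderedField) →
    let open Spectral ℝ in
    (∀ (G : Quiver) → IsSimple G →
    ∀ (k : ℕ) → 1 ≤ k → (k≤n : k ≤ Quiver.n G) → S≤B G k k≤n) →
    (∀ (G : Quiver) →
    ∀ (k : ℕ) → 1 ≤ k → (k≤n : k ≤ Quiver.n G) → S≤B G k k≤n)
theorem2 ℝ = Reduction.simple-S≤B⇒S≤B ℝ
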